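{- Let $m, k$ be positive integers with $\gcd(k,m)=1$, let $r\in\{1,\ldots,m-1\}$ be such that $kr\equiv 1 \pmod m$, and let $\alpha,\gamma\in\{0,1\}$. Put $q=2^m$ and $\sigma=2^k$. Then the mapping $H_{\alpha,\gamma}: x\mapsto H_{\alpha,\gamma}(x)$, $x\in\mathbf{F}_q$, maps $\mathbf{T}_0$ bijectively to $\mathbf{T}_0$, and maps $\mathbf{T}_1$ bijectively to $\mathbf{T}_{r+(\alpha+\gamma)m}$. In particular, the polynomial $H_{\alpha,\gamma}(X)$ is a permutation polynomial of $\mathbf{F}_{2^m}$ if and only if $r+(\alpha+\gamma)m\equiv 1 \pmod 2$.
   Context: $\mathbf{F}_q$ denotes the finite field with $q=2^m$ elements. A polynomial over $\mathbf{F}_q$ is a permutation polynomial of $\mathbf{F}_q$ if its associated function $\mathbf{F}_q\to\mathbf{F}_q$ is a bijection. $\mathrm{Tr}(X)=X+X^2+\cdots+X^{2^{m-1}}\in\mathbf{F}_2[X]$; on $\mathbf{F}_q$ it induces the trace from $\mathbf{F}_q$ to $\mathbf{F}_2$. For $e\in\mathbf{F}_2$, $\mathbf{T}_e=\{x\in\mathbf{F}_q\mid \mathrm{Tr}(x)=e\}$; an integer subscript is read modulo 2. For $\alpha,\gamma\in\{0,1\}$, $$H_{\alpha,\gamma}(X)=\gamma\,\mathrm{Tr}(X)+\frac{\left(\alpha\,\mathrm{Tr}(X)+\sum_{i=0}^{r-1}X^{\sigma^i}\right)^{\sigma+1}}{X^2},$$ which is a polynomial in $X$ with coefficients in $\mathbf{F}_2$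 (the division is performed in $\mathbf{F}_2[X]$), and $H_{\alpha,\gamma}(0)=0$. -}

module Defs where

open import Algebra.Bundles using (CommutativeRing; RawSemiring)
import Algebra.Definitions
import Algebra.Definitions.RawSemiring
import Algebra.Properties.Semiring.Mult
open import Data.Bool.Base using (Bool; if_then_else_)
open import Data.Bool.Properties using (xor-∧-commutativeRing)
open import Data.Fin.Base using (Fin; toℕ)
import Data.Fin.Base as Fin
open import Data.List.Base using (List; []; _∷_; map; foldr; drop)
open import Data.Nat.Base as ℕ using (ℕ; zero; suc; z≤n; s≤s)
open import Data.Nat.DivMod using (_%_)
import Data.Nat.Properties as ℕₚ
open import Data.Product.Base as Product using (∃; proj₁; _,_)
open import Function.Base using (_on_)
open import Function.Bundles using (Inverse)
open import Function.Definitions using (Bijective)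
open import Level using (_⊔_)
import Level
open import Relation.Binary.Bundles using (Setoid)
open import Relation.Binary.PropositionalEquality as ≡ using (_≡_)
open import Relation.Nullary.Negation using (¬_)
open import Relation.Unary using (Pred)

------------------------------------------------------------------------
-- Fields

record Field c ℓ : Set (Level.suc (c ⊔ ℓ)) where
  field
    commutativeRing : CommutativeRing c ℓ

  open CommutativeRing commutativeRing public
  open Algebra.Definitions _≈_ using (Invertible)

  field
    0≉1        : ¬ (0# ≈ 1#)
    invertible : ∀ {x} → ¬ (x ≈ 0#) → Invertible 1# _*_ x

HasOrder : ∀ {c ℓ} → Field c ℓ → ℕ → Set (c ⊔ ℓ)
HasOrder 𝔽 n = Inverse (≡.setoid (Fin n)) (Field.setoid 𝔽)

-- Addition is _xor_ and multiplication is _∧_.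
F₂ : CommutativeRing _ _
F₂ = xor-∧-commutativeRing

------------------------------------------------------------------------
-- Univariate polynomials

module Polynomial {c ℓ} (R : CommutativeRing c ℓ) where

  open CommutativeRing R

  -- Coefficients, lowest degree first; trailing zeros are allowed, and
  -- equality (≈ₚ) is equality of all coefficients.
  Poly : Set c
  Poly = List Carrier

  coeff : Poly → ℕ → Carrier
  coeff []      _       = 0#
  coeff (a ∷ p) zero    = a
  coeff (a ∷ p) (suc i) = coeff p i

  infix  4 _≈ₚ_
  infixl 6 _+ₚ_
  infixl 7 _*ₚ_

  _≈ₚ_ : Poly → Poly → Set ℓ
  p ≈ₚ q = ∀ i → coeff p i ≈ coeff q i

  _+ₚ_ : Poly → Poly → Poly
  []      +ₚ q       = q
  (a ∷ p) +ₚ []      = a ∷ p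
  (a ∷ p) +ₚ (b ∷ q) = a + b ∷ p +ₚ q

  _*ₚ_ : Poly → Poly → Poly
  []      *ₚ q = []
  (a ∷ p) *ₚ q = map (a *_) q +ₚ (0# ∷ p *ₚ q)

  rawSemiring : RawSemiring c ℓ
  rawSemiring = record
    { Carrier = Poly
    ; _≈_     = _≈ₚ_
    ; _+_     = _+ₚ_
    ; _*_     = _*ₚ_
    ; 0#      = []
    ; 1#      = 1# ∷ []
    }

  open Algebra.Definitions.RawSemiring rawSemiring public
    using (_^_; _×_; sum)

  X : Poly
  X = 0# ∷ 1# ∷ []

  -- The quotient on division by X²; the remainder consists of the two
  -- lowest coefficients.
  _/X² : Poly → Poly
  p /X² = drop 2 p

  ⟦_⟧ : Poly → Carrier → Carrier
  ⟦ p ⟧ x = foldr (λ a v → a + x * v) 0# p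

  IsPermutationPolynomial : Poly → Set (c ⊔ ℓ)
  IsPermutationPolynomial p = Bijective _≈_ _≈_ ⟦ p ⟧

  ----------------------------------------------------------------------
  -- Divisibility of powers by X²

  open import Relation.Binary.Reasoning.Setoid setoid

  coeff-+ : ∀ p q i → coeff (p +ₚ q) i ≈ coeff p i + coeff q i
  coeff-+ []      q       i       = sym (+-identityˡ _)
  coeff-+ (a ∷ p) []      i       = sym (+-identityʳ _)
  coeff-+ (a ∷ p) (b ∷ q) zero    = refl
  coeff-+ (a ∷ p) (b ∷ q) (suc i) = coeff-+ p q i

  coeff-map : ∀ a p i → coeff (map (a *_) p) i ≈ a * coeff p i
  coeff-map a []      i       = sym (zeroʳ a)
  coeff-map a (b ∷ p) zero    = refl
  coeff-map a (b ∷ p) (suc i) = coeff-map a p i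

  coeff-* : ∀ a p q i →
            coeff ((a ∷ p) *ₚ q) i ≈ a * coeff q i + coeff (0# ∷ p *ₚ q) i
  coeff-* a p q i =
    trans (coeff-+ (map (a *_) q) _ i) (+-congʳ (coeff-map a q i))

  -- X ^ n divides p.
  Vanishes : ℕ → Poly → Set ℓ
  Vanishes n p = ∀ i → i ℕ.< n → coeff p i ≈ 0#

  vanishes-+ : ∀ {n} p q → Vanishes n p → Vanishes n q → Vanishes n (p +ₚ q)
  vanishes-+ p q vp vq i i<n =
    trans (coeff-+ p q i) (trans (+-cong (vp i i<n) (vq i i<n)) (+-identityˡ 0#))

  vanishes-*ʳ : ∀ {n} p q → Vanishes n q → Vanishes n (p *ₚ q)
  vanishes-0∷ : ∀ {n} p q → Vanishes n q → Vanishes (suc n) (0# ∷ p *ₚ q)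
  vanishes-*ʳ []      q vq i i<n = refl
  vanishes-*ʳ (a ∷ p) q vq i i<n = begin
    coeff ((a ∷ p) *ₚ q) i                  ≈⟨ coeff-* a p q i ⟩
    a * coeff q i + coeff (0# ∷ p *ₚ q) i   ≈⟨ +-cong (*-congˡ (vq i i<n)) (vanishes-0∷ p q vq i (ℕₚ.m<n⇒m<1+n i<n)) ⟩
    a * 0# + 0#                             ≈⟨ +-identityʳ _ ⟩
    a * 0#                                  ≈⟨ zeroʳ a ⟩
    0#                                      ∎
  vanishes-0∷ p q vq zero    _         = refl
  vanishes-0∷ p q vq (suc i) (s≤s i<n) = vanishes-*ʳ p q vq i i<n

  vanishes-* : ∀ {n} p q → Vanishes 1 p → Vanishes n q → Vanishes (suc n) (p *ₚ q)
  vanishes-* []      q vp vq i i<n = refl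
  vanishes-* (a ∷ p) q vp vq i i<n = begin
    coeff ((a ∷ p) *ₚ q) i                  ≈⟨ coeff-* a p q i ⟩
    a * coeff q i + coeff (0# ∷ p *ₚ q) i   ≈⟨ +-cong (*-congʳ (vp 0 (s≤s z≤n))) (vanishes-0∷ p q vq i i<n) ⟩
    0# * coeff q i + 0#                     ≈⟨ +-identityʳ _ ⟩
    0# * coeff q i                          ≈⟨ zeroˡ _ ⟩
    0#                                      ∎

  vanishes-^ : ∀ p → Vanishes 1 p → ∀ n → Vanishes n (p ^ n)
  vanishes-^ p vp zero    i ()
  vanishes-^ p vp (suc n) = vanishes-* p (p ^ n) vp (vanishes-^ p vp n)

  vanishes-X^ : ∀ n .{{_ : ℕ.NonZero n}} → Vanishes 1 (X ^ n)
  vanishes-X^ n i (s≤s z≤n) = vanishes-^ X vX n 0 (ℕ.>-nonZero⁻¹ n)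
    where
    vX : Vanishes 1 X
    vX zero    _         = refl
    vX (suc i) (s≤s ())

  vanishes-sum : ∀ {k n} (f : Fin n → Poly) → (∀ j → Vanishes k (f j)) → Vanishes k (sum f)
  vanishes-sum {n = zero}  f vf i _ = refl
  vanishes-sum {n = suc n} f vf =
    vanishes-+ (f Fin.zero) _ (vf Fin.zero) (vanishes-sum (λ j → f (Fin.suc j)) (λ j → vf (Fin.suc j)))

  vanishes-× : ∀ {k} n p → Vanishes k p → Vanishes k (n × p)
  vanishes-× zero    p vp i _ = refl
  vanishes-× (suc n) p vp = vanishes-+ p (n × p) vp (vanishes-× n p vp)

  X*p≈0∷p : ∀ p → X *ₚ p ≈ₚ 0# ∷ p
  X*p≈0∷p p zero = trans (coeff-* 0# (1# ∷ []) p 0)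
    (trans (+-identityʳ _) (zeroˡ _))
  X*p≈0∷p p (suc i) = begin
    coeff (X *ₚ p) (suc i)                         ≈⟨ coeff-* 0# (1# ∷ []) p (suc i) ⟩
    0# * coeff p (suc i) + coeff ((1# ∷ []) *ₚ p) i ≈⟨ +-cong (zeroˡ _) (coeff-* 1# [] p i) ⟩
    0# + (1# * coeff p i + coeff (0# ∷ []) i)      ≈⟨ +-identityˡ _ ⟩
    1# * coeff p i + coeff (0# ∷ []) i             ≈⟨ +-cong (*-identityˡ _) (0∷[] i) ⟩
    coeff p i + 0#                                 ≈⟨ +-identityʳ _ ⟩
    coeff p i                                      ∎
    where
    0∷[] : ∀ i → coeff (0# ∷ []) i ≈ 0#
    0∷[] zero    = refl
    0∷[] (suc i) = refl

  /X²-exact : ∀ p → Vanishes 2 p → X *ₚ (X *ₚ (p /X²)) ≈ₚ p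
  /X²-exact p vp i = trans (X*p≈0∷p (X *ₚ (p /X²)) i) (lemma p vp i)
    where
    lemma : ∀ p → Vanishes 2 p → 0# ∷ (X *ₚ (p /X²)) ≈ₚ p
    lemma p           vp zero          = sym (vp 0 (s≤s z≤n))
    lemma p           vp (suc zero)    = trans (X*p≈0∷p (p /X²) 0) (sym (vp 1 (s≤s (s≤s z≤n))))
    lemma []          vp (suc (suc i)) = X*p≈0∷p [] (suc i)
    lemma (a ∷ [])    vp (suc (suc i)) = X*p≈0∷p [] (suc i)
    lemma (a ∷ b ∷ p) vp (suc (suc i)) = X*p≈0∷p p (suc i)

------------------------------------------------------------------------
-- The polynomials Tr and H over F₂

module _ where

  open Polynomial F₂

  Tr : ℕ → Poly
  Tr m = sum {m} λ i → X ^ (2 ℕ.^ toℕ i)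

  module _ (m k r : ℕ) (α γ : Fin 2) where

    private
      σ = 2 ℕ.^ k

    base : Poly
    base = toℕ α × Tr m +ₚ sum {r} λ i → X ^ (σ ℕ.^ toℕ i)

    numerator : Poly
    numerator = base ^ (σ ℕ.+ 1)

    H : Poly
    H = toℕ γ × Tr m +ₚ numerator /X²

    -- The division in H leaves no remainder.
    numerator-exact : X *ₚ (X *ₚ (numerator /X²)) ≈ₚ numerator
    numerator-exact = /X²-exact numerator λ i i<2 →
      vanishes-^ base vbase (σ ℕ.+ 1) i (ℕₚ.<-≤-trans i<2 (ℕₚ.+-monoˡ-≤ 1 (ℕₚ.m^n>0 2 k)))
      where
      vbase : Vanishes 1 base
      vbase = vanishes-+ (toℕ α × Tr m) _
        (vanishes-× (toℕ α) (Tr m)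
          (vanishes-sum {n = m} _ λ j → vanishes-X^ _ {{ℕₚ.m^n≢0 2 (toℕ j)}}))
        (vanishes-sum {n = r} _ λ j →
          vanishes-X^ _ {{ℕₚ.m^n≢0 σ (toℕ j) {{ℕₚ.m^n≢0 2 k}}}})

------------------------------------------------------------------------
-- Maps between subsets of a setoid

module _ {c ℓ} (S : Setoid c ℓ) where

  open Setoid S

  MapsBijectively : ∀ {a b} → (Carrier → Carrier) →
                    Pred Carrier a → Pred Carrier b → Set (c ⊔ ℓ ⊔ a ⊔ b)
  MapsBijectively f A B = ∃ λ (maps : ∀ {x} → A x → B (f x)) →
    Bijective {A = ∃ A} {B = ∃ B} (_≈_ on proj₁) (_≈_ on proj₁) (Product.map f maps)

------------------------------------------------------------------------
-- Polynomials over F₂ seen over a field 𝔽, intended to have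
-- characteristic 2

module Over {c ℓ} (𝔽 : Field c ℓ) where

  open Field 𝔽
  open Algebra.Properties.Semiring.Mult semiring using (_×_)
  open Polynomial commutativeRing public using (⟦_⟧; IsPermutationPolynomial)

  embed : Bool → Carrier
  embed b = if b then 1# else 0#

  baseChange : Polynomial.Poly F₂ → Polynomial.Poly commutativeRing
  baseChange = map embed

  -- The subscript is read modulo 2.
  𝐓 : ℕ → ℕ → Pred Carrier ℓ
  𝐓 m e x = ⟦ baseChange (Tr m) ⟧ x ≈ (e % 2) × 1#

{-# OPTIONS --safe #-}

-- Put φ x = x^σ, L = α Tr + Σ_{i<r} φⁱ and y = L x.  As φʳ is squaring, L
-- telescopes: L (φ z + z) = z² + z, and φ y + y = x² + x.  For x ≠ 0 the value
-- h = y φ(y) / x² factors as h = u w with u = y / x, w = φ(y) / x and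
-- u + w = x + 1, whence u² + u + h = y and w² + w + h = φ y.  Let x, x′ have the
-- same h and the same trace, and put d = u + u′, e = w + w′.  Then d² + d = y + y′
-- and e² + e = φ(d² + d), so e + φ d ∈ F₂.  It is 0: otherwise comparing the
-- values of Tr and L on x + x′ = φ d + d + 1 makes both m and r even, against
-- k r ≡ 1 (mod m).  Now d²/(y y′) = e²/(φ y φ y′) is fixed by φ, hence lies in
-- F₂.  The value 0 gives x = x′; the value 1 gives x = φ v + v for
-- v = y / y′ + y, where v² + v + 1 = y, contradicting L x = v² + v.

module Submission where

open import Defs

import Algebra.Properties.CommutativeMonoid.Mult
import Algebra.Properties.CommutativeMonoid.Sum
import Algebra.Properties.CommutativeSemiring.Exp
import Algebra.Properties.Group
import Algebra.Properties.Ring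
import Algebra.Properties.Semiring.Exp
import Algebra.Properties.Semiring.Mult
import Algebra.Solver.Ring
open import Algebra.Bundles using (CommutativeRing)
open import Algebra.Solver.Ring.AlmostCommutativeRing
  using (fromCommutativeSemiring; _-Raw-AlmostCommutative⟶_; Induced-equivalence)
open import Data.Bool.Base using (true; false; _xor_; _∧_)
import Data.Bool.Properties as Boolₚ
open import Data.Fin.Base using (Fin; zero; suc; toℕ; punchIn; punchOut)
open import Data.Fin.Permutation as Perm using (Permutation′; _⟨$⟩ʳ_)
import Data.Fin.Properties as Finₚ
open import Data.List.Base using ([]; _∷_; map)
import Data.Maybe.Base as Maybe
open import Data.Nat.Base as ℕ using (ℕ; zero; suc; NonZero; z≤n; s≤s)
open import Data.Nat.DivMod using (_%_; _/_; m≡m%n+[m/n]*n; m%n<n; m<n⇒m%n≡m)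
import Data.Nat.Properties as ℕₚ
open import Data.Product.Base as Product using (∃; _,_; proj₁; proj₂)
open import Data.Sum.Base as Sum using (_⊎_; inj₁; inj₂; [_,_]′)
open import Data.Unit.Base using (⊤; tt)
open import Function.Base using (_∘_; id; const)
open import Function.Bundles using (Inverse; _⇔_; mk⇔)
open import Function.Definitions using (Injective)
import Level
open import Relation.Binary.Bundles using (Setoid)
open import Relation.Binary.Definitions as Binary using (WeaklyDecidable)
open import Relation.Binary.PropositionalEquality as ≡ using (_≡_)
import Relation.Binary.Reasoning.Setoid
open import Relation.Nullary using (¬_; Dec; yes; no; contradiction)
open import Relation.Nullary.Decidable using (map′; dec⇒maybe)
open import Relation.Unary using (Pred; Decidable)

-- Counting on finite types and finite setoids.

injective⇒surjective : ∀ {n} (f : Fin n → Fin n) → Injective _≡_ _≡_ f → ∀ j → ∃ λ i → f i ≡ j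
injective⇒surjective {suc n} f f-inj j with Finₚ.any? (λ i → f i Finₚ.≟ j)
... | yes i↦j = i↦j
-- Pigeonhole: if `j` were missed, punching it out would inject `Fin (suc n)` into `Fin n`.
... | no  ∄i  = contradiction (Finₚ.injective⇒≤ {f = f-j} f-j-inj) ℕₚ.1+n≰n
  where
  j≢f : ∀ i → j ≡.≢ f i
  j≢f i j≡fi = ∄i (i , ≡.sym j≡fi)
  f-j : Fin (suc n) → Fin n
  f-j i = punchOut (j≢f i)
  f-j-inj : Injective _≡_ _≡_ f-j
  f-j-inj {x} {y} eq = f-inj (Finₚ.punchOut-injective (j≢f x) (j≢f y) eq)

module FiniteSetoid {c ℓ} (S : Setoid c ℓ) {n : ℕ} (enum : Inverse (≡.setoid (Fin n)) S) where

  open Setoid S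
  open Inverse enum

  to∘from : ∀ x → to (from x) ≈ x
  to∘from x = inverseˡ ≡.refl

  from∘to : ∀ i → from (to i) ≡ i
  from∘to i = inverseʳ refl

  from-injective : ∀ {x y} → from x ≡ from y → x ≈ y
  from-injective {x} {y} eq = trans (sym (to∘from x)) (trans (to-cong eq) (to∘from y))

  infix 4 _≟_
  _≟_ : ∀ x y → Dec (x ≈ y)
  x ≟ y = map′ from-injective from-cong (from x Finₚ.≟ from y)

  -- An injection A → B is onto as soon as the complement of A embeds into
  -- that of B: glue the two injections and count.
  glued-surjective : ∀ {a b} {A : Pred Carrier a} {B : Pred Carrier b} → Decidable A →
    (f g : Carrier → Carrier) →
    (∀ {x} → A x → B (f x)) → (∀ {x} → ¬ A x → ¬ B (g x)) →
    (∀ {x y} → x ≈ y → B x → B y) →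
    (∀ {x y} → A x → A y → f x ≈ f y → x ≈ y) →
    (∀ {x y} → g x ≈ g y → x ≈ y) →
    ∀ {y} → B y → ∃ λ x → A x Product.× f x ≈ y
  glued-surjective {A = A} {B} A? f g f-maps g-maps B-resp f-inj g-inj {y} By =
    result (A? (to i)) (trans (sym (to∘from _)) (trans (to-cong i↦y) (to∘from y)))
    where
    glue : ∀ x → Dec (A x) → Carrier
    glue x (yes _) = f x
    glue x (no _)  = g x
    glue-inj : ∀ {x x′} (d : Dec (A x)) (d′ : Dec (A x′)) → glue x d ≈ glue x′ d′ → x ≈ x′
    glue-inj (yes Ax) (yes Ax′) eq = f-inj Ax Ax′ eq
    -- Values of the two pieces never meet, because `f` lands in `B` and `g` outside it.
    glue-inj (yes Ax) (no ¬Ax′) eq = contradiction (B-resp eq (f-maps Ax)) (g-maps ¬Ax′)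
    glue-inj (no ¬Ax) (yes Ax′) eq = contradiction (B-resp (sym eq) (f-maps Ax′)) (g-maps ¬Ax)
    glue-inj (no _)   (no _)    eq = g-inj eq
    φ : Fin n → Fin n
    φ i = from (glue (to i) (A? (to i)))
    φ-inj : Injective _≡_ _≡_ φ
    φ-inj {i} {j} eq = ≡.trans (≡.sym (from∘to i)) (≡.trans
      (from-cong (glue-inj (A? (to i)) (A? (to j)) (from-injective eq))) (from∘to j))
    i = proj₁ (injective⇒surjective φ φ-inj (from y))
    i↦y : φ i ≡ from y
    i↦y = proj₂ (injective⇒surjective φ φ-inj (from y))
    result : ∀ {x} (d : Dec (A x)) → glue x d ≈ y → ∃ λ x → A x Product.× f x ≈ y
    result {x} (yes Ax) eq = x , Ax , eq
    result     (no ¬Ax) eq = contradiction (B-resp (sym eq) By) (g-maps ¬Ax)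

-- Finite fields: Fermat's theorem and the characteristic.

module FieldProperties {c ℓ} (𝔽 : Field c ℓ) where
  open Field 𝔽 hiding (zero)
  open Relation.Binary.Reasoning.Setoid setoid

  *-cancelʳ : ∀ {x y z} → z ≉ 0# → x * z ≈ y * z → x ≈ y
  *-cancelʳ {x} {y} {z} z≉0 eq = let z⁻¹ , _ , z*z⁻¹≈1 = invertible z≉0 in begin
    x              ≈⟨ *-identityʳ x ⟨
    x * 1#         ≈⟨ *-congˡ z*z⁻¹≈1 ⟨
    x * (z * z⁻¹)  ≈⟨ *-assoc x z z⁻¹ ⟨
    (x * z) * z⁻¹  ≈⟨ *-congʳ eq ⟩
    (y * z) * z⁻¹  ≈⟨ *-assoc y z z⁻¹ ⟩
    y * (z * z⁻¹)  ≈⟨ *-congˡ z*z⁻¹≈1 ⟩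
    y * 1#         ≈⟨ *-identityʳ y ⟩
    y              ∎

  *-nonzero : ∀ {x y} → x ≉ 0# → y ≉ 0# → x * y ≉ 0#
  *-nonzero x≉0 y≉0 xy≈0 = x≉0 (*-cancelʳ y≉0 (trans xy≈0 (sym (zeroˡ _))))

module FiniteField {c ℓ} (𝔽 : Field c ℓ) {n : ℕ} (enum : HasOrder 𝔽 (suc n)) where

  open Field 𝔽 hiding (zero)
  open FieldProperties 𝔽
  open FiniteSetoid setoid enum public
  open Inverse enum using (to; from; from-cong)
  open Algebra.Properties.CommutativeMonoid.Sum *-commutativeMonoid
    using () renaming (sum to product; sum-permute to product-permute; sum-cong-≋ to product-cong;
                       ∑-distrib-+ to product-distrib-*; sum-replicate to product-replicate)
  open Algebra.Properties.Semiring.Exp semiring using (_^_)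
  open Relation.Binary.Reasoning.Setoid setoid

  product-nonzero : ∀ {m} (f : Fin m → Carrier) → (∀ i → f i ≉ 0#) → product f ≉ 0#
  product-nonzero {zero}  f f≉0 = 0≉1 ∘ sym
  product-nonzero {suc m} f f≉0 = *-nonzero (f≉0 zero) (product-nonzero (f ∘ suc) (f≉0 ∘ suc))

  -- Multiplication by a permutes the nonzero elements, hence fixes their product.
  lagrange : ∀ {a} → a ≉ 0# → a ^ n ≈ 1#
  lagrange {a} a≉0 = *-cancelʳ (product-nonzero unit unit≉0) (begin
    a ^ n * product unit                ≈⟨ *-congʳ (product-replicate n) ⟨
    product (const {B = Fin n} a) * product unit  ≈⟨ product-distrib-* (const a) unit ⟨
    product (λ i → a * unit i)          ≈⟨ product-cong unit-permuted ⟨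
    product (unit ∘ (remove-π ⟨$⟩ʳ_))   ≈⟨ product-permute unit remove-π ⟨
    product unit                        ≈⟨ *-identityˡ _ ⟨
    1# * product unit                   ∎)
    where
    a⁻¹ = proj₁ (invertible a≉0)
    o = from 0#
    -- Skipping the index `o` of zero enumerates exactly the nonzero elements.
    unit : Fin n → Carrier
    unit j = to (punchIn o j)
    unit≉0 : ∀ j → unit j ≉ 0#
    unit≉0 j eq = Finₚ.punchInᵢ≢i o j (≡.trans (≡.sym (from∘to _)) (from-cong eq))
    *a : Carrier → Fin (suc n) → Fin (suc n)
    *a b i = from (b * to i)
    inv : ∀ b c → b * c ≈ 1# → ∀ i → *a b (*a c i) ≡ i
    inv b c bc≈1 i = ≡.trans (from-cong (begin
      b * to (from (c * to i))  ≈⟨ *-congˡ (to∘from _) ⟩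
      b * (c * to i)            ≈⟨ *-assoc b c (to i) ⟨
      (b * c) * to i            ≈⟨ *-congʳ bc≈1 ⟩
      1# * to i                 ≈⟨ *-identityˡ _ ⟩
      to i                      ∎)) (from∘to i)
    π : Permutation′ (suc n)
    π = Perm.permutation (*a a) (*a a⁻¹)
      (inv a a⁻¹ (proj₂ (proj₂ (invertible a≉0)))) (inv a⁻¹ a (proj₁ (proj₂ (invertible a≉0))))
    π-o : π ⟨$⟩ʳ o ≡ o
    π-o = from-cong (trans (*-congˡ (to∘from 0#)) (zeroʳ a))
    -- Multiplication by `a` fixes the index of zero, so deleting that index leaves a permutation of
    -- the nonzero ones.
    remove-π = Perm.remove o π
    unit-permuted : ∀ j → unit (remove-π ⟨$⟩ʳ j) ≈ a * unit j
    unit-permuted j = begin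
      to (punchIn o (remove-π ⟨$⟩ʳ j))           ≡⟨ ≡.cong (λ i → to (punchIn i (remove-π ⟨$⟩ʳ j))) π-o ⟨
      to (punchIn (π ⟨$⟩ʳ o) (remove-π ⟨$⟩ʳ j))  ≡⟨ ≡.cong to (Perm.punchIn-permute π o j) ⟨
      to (from (a * unit j))                     ≈⟨ to∘from _ ⟩
      a * unit j                                 ∎

-- This form of Fermat's theorem covers zero as well. Together with decidable equality and
-- characteristic 2 it is all that the injectivity argument needs to know of finiteness.
FixedByPower : ∀ {c ℓ} → Field c ℓ → ℕ → Set (c Level.⊔ ℓ)
FixedByPower 𝔽 n = ∀ x → x ^ n ≈ x
  where
  open Field 𝔽
  open Algebra.Properties.Semiring.Exp semiring using (_^_)

fermat : ∀ {c ℓ} (𝔽 : Field c ℓ) {n} → HasOrder 𝔽 n → FixedByPower 𝔽 n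
fermat 𝔽 {zero}  enum x = contradiction (Inverse.from enum x) λ ()
fermat 𝔽 {suc n} enum x with FiniteField._≟_ 𝔽 enum x (Field.0# 𝔽)
... | yes x≈0 = trans (*-congʳ x≈0) (trans (zeroˡ _) (sym x≈0))
  where open Field 𝔽
... | no  x≉0 = trans (*-congˡ (FiniteField.lagrange 𝔽 enum x≉0)) (*-identityʳ x)
  where open Field 𝔽

HasCharacteristic2 : ∀ {c ℓ} → Field c ℓ → Set ℓ
HasCharacteristic2 𝔽 = 1# + 1# ≈ 0#
  where open Field 𝔽

-- By Fermat's theorem for -1, whose even powers are 1.
even-order⇒1+1≈0 : ∀ {c ℓ} (𝔽 : Field c ℓ) l → HasOrder 𝔽 (2 ℕ.* l) → HasCharacteristic2 𝔽
even-order⇒1+1≈0 𝔽 l enum = begin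
  1# + 1#                            ≈⟨ +-congˡ (1^ l) ⟨
  1# + 1# ^ l                        ≈⟨ +-congˡ (^-congˡ l -1²≈1) ⟨
  1# + ((- 1#) ^ 2) ^ l              ≈⟨ +-congˡ (^-assocʳ (- 1#) 2 l) ⟩
  1# + (- 1#) ^ (2 ℕ.* l)            ≈⟨ +-congˡ (fermat 𝔽 enum (- 1#)) ⟩
  1# + - 1#                          ≈⟨ -‿inverseʳ 1# ⟩
  0#                                 ∎
  where
  open Field 𝔽 hiding (zero)
  open Algebra.Properties.Semiring.Exp semiring using (_^_; ^-congˡ; ^-assocʳ)
  open Algebra.Properties.Ring ring using (-1*x≈-x)
  open Algebra.Properties.Group +-group using (⁻¹-involutive)
  open Relation.Binary.Reasoning.Setoid setoid
  -1²≈1 : (- 1#) ^ 2 ≈ 1#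
  -1²≈1 = trans (*-congˡ (*-identityʳ _)) (trans (-1*x≈-x (- 1#)) (⁻¹-involutive 1#))
  1^ : ∀ n → 1# ^ n ≈ 1#
  1^ zero    = refl
  1^ (suc n) = trans (*-identityˡ _) (1^ n)

-- Characteristic two: solver and evaluation of polynomials over F₂.

module CharacteristicTwo {c ℓ} (𝔽 : Field c ℓ) (1+1≈0 : HasCharacteristic2 𝔽) where

  open Field 𝔽 hiding (zero)
  open Over 𝔽
  open Algebra.Properties.Semiring.Exp semiring using (_^_; ^-congˡ; ^-assocʳ)
  open Relation.Binary.Reasoning.Setoid setoid

  x+x≈0 : ∀ x → x + x ≈ 0#
  x+x≈0 x = begin
    x + x            ≈⟨ +-cong (*-identityˡ x) (*-identityˡ x) ⟨
    1# * x + 1# * x  ≈⟨ distribʳ x 1# 1# ⟨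
    (1# + 1#) * x    ≈⟨ *-congʳ 1+1≈0 ⟩
    0# * x           ≈⟨ zeroˡ x ⟩
    0#               ∎

  x+y≈0⇒x≈y : ∀ {x y} → x + y ≈ 0# → x ≈ y
  x+y≈0⇒x≈y {x} {y} eq = begin
    x            ≈⟨ +-identityʳ x ⟨
    x + 0#       ≈⟨ +-congˡ (x+x≈0 y) ⟨
    x + (y + y)  ≈⟨ +-assoc x y y ⟨
    (x + y) + y  ≈⟨ +-congʳ eq ⟩
    0# + y       ≈⟨ +-identityˡ y ⟩
    y            ∎

  x≈y⇒x+y≈0 : ∀ {x y} → x ≈ y → x + y ≈ 0#
  x≈y⇒x+y≈0 {x} {y} eq = trans (+-congʳ eq) (x+x≈0 y)

  embed-xor : ∀ a b → embed (a xor b) ≈ embed a + embed b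
  embed-xor false b     = sym (+-identityˡ _)
  embed-xor true  false = sym (+-identityʳ _)
  embed-xor true  true  = sym 1+1≈0

  embed-∧ : ∀ a b → embed (a ∧ b) ≈ embed a * embed b
  embed-∧ false b = sym (zeroˡ _)
  embed-∧ true  b = sym (*-identityˡ _)

  -- Negation is the identity on both sides, which is why a commutative semiring suffices as the
  -- target.
  embed-morphism : CommutativeRing.rawRing F₂ -Raw-AlmostCommutative⟶ fromCommutativeSemiring commutativeSemiring
  embed-morphism = record
    { ⟦_⟧    = embed
    ; +-homo = embed-xor
    ; *-homo = embed-∧
    ; -‿homo = λ _ → refl
    ; 0-homo = refl
    ; 1-homo = refl
    }

  embed-≟ : WeaklyDecidable (Induced-equivalence embed-morphism)
  embed-≟ a b = Maybe.map (reflexive ∘ ≡.cong embed) (dec⇒maybe (a Boolₚ.≟ b))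

  -- With coefficients in F₂ the solver decides identities modulo 2.
  module Solver = Algebra.Solver.Ring (CommutativeRing.rawRing F₂)
    (fromCommutativeSemiring commutativeSemiring) embed-morphism embed-≟

  module _ (x : Carrier) where

    open Polynomial F₂ using (_+ₚ_; _*ₚ_; X; Vanishes; _/X²)
      renaming (_^_ to _^ₚ_; _×_ to _×ₚ_; sum to sumₚ)

    eval : Polynomial.Poly F₂ → Carrier
    eval p = ⟦ baseChange p ⟧ x

    open Solver using (solve; _:=_; _:+_; _:*_; con)

    eval-+ : ∀ p q → eval (p +ₚ q) ≈ eval p + eval q
    eval-+ []      q       = sym (+-identityˡ _)
    eval-+ (a ∷ p) []      = sym (+-identityʳ _)
    eval-+ (a ∷ p) (b ∷ q) = begin
      embed (a xor b) + x * eval (p +ₚ q)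
        ≈⟨ +-cong (embed-xor a b) (*-congˡ (eval-+ p q)) ⟩
      (embed a + embed b) + x * (eval p + eval q)
        ≈⟨ solve 5 (λ a b x p q → (a :+ b) :+ x :* (p :+ q) := (a :+ x :* p) :+ (b :+ x :* q))
             refl (embed a) (embed b) x (eval p) (eval q) ⟩
      (embed a + x * eval p) + (embed b + x * eval q) ∎

    eval-scale : ∀ a p → eval (map (a ∧_) p) ≈ embed a * eval p
    eval-scale a []      = sym (zeroʳ _)
    eval-scale a (b ∷ p) = begin
      embed (a ∧ b) + x * eval (map (a ∧_) p)
        ≈⟨ +-cong (embed-∧ a b) (*-congˡ (eval-scale a p)) ⟩
      embed a * embed b + x * (embed a * eval p)
        ≈⟨ solve 4 (λ a b x p → a :* b :+ x :* (a :* p) := a :* (b :+ x :* p))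
             refl (embed a) (embed b) x (eval p) ⟩
      embed a * (embed b + x * eval p) ∎

    eval-* : ∀ p q → eval (p *ₚ q) ≈ eval p * eval q
    eval-* []      q = sym (zeroˡ _)
    eval-* (a ∷ p) q = begin
      eval (map (a ∧_) q +ₚ (false ∷ p *ₚ q))
        ≈⟨ eval-+ (map (a ∧_) q) (false ∷ p *ₚ q) ⟩
      eval (map (a ∧_) q) + (0# + x * eval (p *ₚ q))
        ≈⟨ +-cong (eval-scale a q) (+-congˡ (*-congˡ (eval-* p q))) ⟩
      embed a * eval q + (0# + x * (eval p * eval q))
        ≈⟨ solve 4 (λ a q x p → a :* q :+ (con false :+ x :* (p :* q)) := (a :+ x :* p) :* q)
             refl (embed a) (eval q) x (eval p) ⟩
      (embed a + x * eval p) * eval q ∎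

    eval-X : eval X ≈ x
    eval-X = solve 1 (λ x → con false :+ x :* (con true :+ x :* con false) := x) refl x

    eval-^ : ∀ p n → eval (p ^ₚ n) ≈ eval p ^ n
    eval-^ p zero    = trans (+-congˡ (zeroʳ x)) (+-identityʳ 1#)
    eval-^ p (suc n) = trans (eval-* p (p ^ₚ n)) (*-congˡ (eval-^ p n))

    eval-X^ : ∀ n → eval (X ^ₚ n) ≈ x ^ n
    eval-X^ n = trans (eval-^ X n) (^-congˡ n eval-X)

    open Algebra.Properties.Semiring.Mult semiring using (_×_)
    open Algebra.Properties.CommutativeMonoid.Sum +-commutativeMonoid using (sum)

    eval-× : ∀ n p → eval (n ×ₚ p) ≈ n × eval p
    eval-× zero    p = refl
    eval-× (suc n) p = trans (eval-+ p (n ×ₚ p)) (+-congˡ (eval-× n p))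

    eval-sum : ∀ {n} (p : Fin n → Polynomial.Poly F₂) → eval (sumₚ p) ≈ sum (eval ∘ p)
    eval-sum {zero}  p = refl
    eval-sum {suc n} p = trans (eval-+ (p zero) _) (+-congˡ (eval-sum (p ∘ suc)))

    -- Equality in F₂ is propositional, so matching on the two vanishing coefficients turns them
    -- into literal zeros, and dropping them divides by X².
    eval-/X² : ∀ p → Vanishes 2 p → x * x * eval (p /X²) ≈ eval p
    eval-/X² []          v = zeroʳ _
    eval-/X² (a ∷ [])    v with ≡.refl ← v 0 (s≤s z≤n) =
      solve 1 (λ x → x :* x :* con false := con false :+ x :* con false) refl x
    eval-/X² (a ∷ b ∷ p) v with ≡.refl ← v 0 (s≤s z≤n) | ≡.refl ← v 1 (s≤s (s≤s z≤n)) =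
      solve 2 (λ x p → x :* x :* p := con false :+ x :* (con false :+ x :* p)) refl x (eval p)

    eval-vanishes : ∀ {n} p → Vanishes (suc n) p → x ≈ 0# → eval p ≈ 0#
    eval-vanishes []      v x≈0 = refl
    eval-vanishes (a ∷ p) v x≈0 with ≡.refl ← v 0 (s≤s z≤n) = begin
      0# + x * eval p  ≈⟨ +-congˡ (*-congʳ x≈0) ⟩
      0# + 0# * eval p ≈⟨ +-congˡ (zeroˡ _) ⟩
      0# + 0#          ≈⟨ +-identityˡ 0# ⟩
      0#               ∎

  eval-cong : ∀ p {x y} → x ≈ y → eval x p ≈ eval y p
  eval-cong []      x≈y = refl
  eval-cong (a ∷ p) x≈y = +-congˡ (*-cong x≈y (eval-cong p x≈y))

  -- Frobenius powers and power sums.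

  open Algebra.Properties.Semiring.Mult semiring using (_×_)
  open Algebra.Properties.CommutativeMonoid.Sum +-commutativeMonoid using (sum; sum-cong-≋)
  open Solver using (solve; _:=_; _:+_; _:*_; con)

  -- Squaring is additive because the cross term occurs twice; induction on `j` peels off one
  -- squaring at a time.
  2^-additive : ∀ j x y → (x + y) ^ (2 ℕ.^ j) ≈ x ^ (2 ℕ.^ j) + y ^ (2 ℕ.^ j)
  2^-additive zero    x y = solve 2 (λ x y → (x :+ y) :* con true := x :* con true :+ y :* con true) refl x y
  2^-additive (suc j) x y = begin
    (x + y) ^ (2 ℕ.* 2 ℕ.^ j)                    ≈⟨ ^-assocʳ (x + y) 2 (2 ℕ.^ j) ⟨
    ((x + y) ^ 2) ^ (2 ℕ.^ j)                    ≈⟨ ^-congˡ (2 ℕ.^ j) square ⟩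
    (x ^ 2 + y ^ 2) ^ (2 ℕ.^ j)                  ≈⟨ 2^-additive j (x ^ 2) (y ^ 2) ⟩
    (x ^ 2) ^ (2 ℕ.^ j) + (y ^ 2) ^ (2 ℕ.^ j)    ≈⟨ +-cong (^-assocʳ x 2 (2 ℕ.^ j)) (^-assocʳ y 2 (2 ℕ.^ j)) ⟩
    x ^ (2 ℕ.* 2 ℕ.^ j) + y ^ (2 ℕ.* 2 ℕ.^ j)    ∎
    where
    square : (x + y) ^ 2 ≈ x ^ 2 + y ^ 2
    square = solve 2 (λ x y → (x :+ y) :* ((x :+ y) :* con true) := x :* (x :* con true) :+ y :* (y :* con true)) refl x y

  1^ : ∀ n → 1# ^ n ≈ 1#
  1^ zero    = refl
  1^ (suc n) = trans (*-identityˡ _) (1^ n)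

  -- The sum of `x ^ (b ^ i)` for `i < n`. One recursion serves both the trace (`b = 2`, `n = m`)
  -- and the sum over powers of σ (`b = σ`, `n = r`).
  powerSum : ℕ → ℕ → Carrier → Carrier
  powerSum b zero    x = 0#
  powerSum b (suc n) x = x + powerSum b n (x ^ b)

  powerSum-cong : ∀ b n {x y} → x ≈ y → powerSum b n x ≈ powerSum b n y
  powerSum-cong b zero    x≈y = refl
  powerSum-cong b (suc n) x≈y = +-cong x≈y (powerSum-cong b n (^-congˡ b x≈y))

  eval-powerSum : ∀ b n x →
    eval x (Polynomial.sum F₂ {n} λ i → Polynomial._^_ F₂ (Polynomial.X F₂) (b ℕ.^ toℕ i)) ≈ powerSum b n x
  eval-powerSum b n x = trans (eval-sum x {n} _) (trans (sum-cong-≋ {n} (λ i → eval-X^ x (b ℕ.^ toℕ i))) (go n x))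
    where
    go : ∀ n x → sum {n} (λ i → x ^ (b ℕ.^ toℕ i)) ≈ powerSum b n x
    go zero    x = refl
    go (suc n) x = +-cong (*-identityʳ x)
      (trans (sum-cong-≋ {n} (λ i → sym (^-assocʳ x b (b ℕ.^ toℕ i)))) (go n (x ^ b)))

  -- Both sides are the sum of `x ^ (b ^ i)` for `i ≤ n`, once with the first term split off and
  -- once with the last.
  powerSum-telescopes : ∀ b n x → powerSum b n (x ^ b) + x ≈ powerSum b n x + x ^ (b ℕ.^ n)
  powerSum-telescopes b zero    x = +-congˡ (sym (*-identityʳ x))
  powerSum-telescopes b (suc n) x = begin
    (x ^ b + s) + x                      ≈⟨ +-congʳ (+-comm _ s) ⟩
    (s + x ^ b) + x                      ≈⟨ +-congʳ (powerSum-telescopes b n (x ^ b)) ⟩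
    (powerSum b n (x ^ b) + (x ^ b) ^ (b ℕ.^ n)) + x  ≈⟨ +-comm _ x ⟩
    x + (powerSum b n (x ^ b) + (x ^ b) ^ (b ℕ.^ n))  ≈⟨ +-assoc x _ _ ⟨
    (x + powerSum b n (x ^ b)) + (x ^ b) ^ (b ℕ.^ n)  ≈⟨ +-congˡ (^-assocʳ x b (b ℕ.^ n)) ⟩
    (x + powerSum b n (x ^ b)) + x ^ (b ℕ.^ suc n)    ∎
    where s = powerSum b n ((x ^ b) ^ b)

  -- Evaluating at 1 reads off the parity of the number of terms.
  powerSum-1 : ∀ b n → powerSum b n 1# ≈ n × 1#
  powerSum-1 b zero    = refl
  powerSum-1 b (suc n) = +-congˡ (trans (powerSum-cong b n (1^ b)) (powerSum-1 b n))

  powerSum-+ : ∀ j n x y → let b = 2 ℕ.^ j in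
    powerSum b n (x + y) ≈ powerSum b n x + powerSum b n y
  powerSum-+ j zero    x y = sym (+-identityˡ 0#)
  powerSum-+ j (suc n) x y = begin
    (x + y) + powerSum b n ((x + y) ^ b)
      ≈⟨ +-congˡ (powerSum-cong b n (2^-additive j x y)) ⟩
    (x + y) + powerSum b n (x ^ b + y ^ b)
      ≈⟨ +-congˡ (powerSum-+ j n (x ^ b) (y ^ b)) ⟩
    (x + y) + (powerSum b n (x ^ b) + powerSum b n (y ^ b))
      ≈⟨ solve 4 (λ x y s t → (x :+ y) :+ (s :+ t) := (x :+ s) :+ (y :+ t)) refl x y _ _ ⟩
    (x + powerSum b n (x ^ b)) + (y + powerSum b n (y ^ b)) ∎
    where b = 2 ℕ.^ j

  powerSum-^ : ∀ i b n x → powerSum b n x ^ (2 ℕ.^ i) ≈ powerSum b n (x ^ (2 ℕ.^ i))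
  -- The empty sum needs a positive exponent, since a zeroth power would be 1.
  powerSum-^ i b zero    x with 2 ℕ.^ i | ℕₚ.m^n>0 2 i
  ... | suc a | _ = zeroˡ _
  powerSum-^ i b (suc n) x = begin
    (x + powerSum b n (x ^ b)) ^ (2 ℕ.^ i)
      ≈⟨ 2^-additive i x _ ⟩
    x ^ (2 ℕ.^ i) + powerSum b n (x ^ b) ^ (2 ℕ.^ i)
      ≈⟨ +-congˡ (powerSum-^ i b n (x ^ b)) ⟩
    x ^ (2 ℕ.^ i) + powerSum b n ((x ^ b) ^ (2 ℕ.^ i))
      ≈⟨ +-congˡ (powerSum-cong b n (begin
           (x ^ b) ^ (2 ℕ.^ i)    ≈⟨ ^-assocʳ x b _ ⟩
           x ^ (b ℕ.* 2 ℕ.^ i)    ≡⟨ ≡.cong (x ^_) (ℕₚ.*-comm b _) ⟩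
           x ^ (2 ℕ.^ i ℕ.* b)    ≈⟨ ^-assocʳ x (2 ℕ.^ i) b ⟨
           (x ^ (2 ℕ.^ i)) ^ b    ∎)) ⟩
    x ^ (2 ℕ.^ i) + powerSum b n ((x ^ (2 ℕ.^ i)) ^ b) ∎

-- Injectivity on elements of equal trace.

module Injectivity {c ℓ} (𝔽 : Field c ℓ)
  (_≟_ : Binary.Decidable (Field._≈_ 𝔽)) (1+1≈0 : HasCharacteristic2 𝔽)
  (m k r t : ℕ) (x^2^m≈x : FixedByPower 𝔽 (2 ℕ.^ m)) (kr≡1+tm : k ℕ.* r ≡ 1 ℕ.+ t ℕ.* m)
  where

  open Field 𝔽 hiding (zero)
  open FieldProperties 𝔽
  open CharacteristicTwo 𝔽 1+1≈0
  open Algebra.Properties.Semiring.Exp semiring using (_^_; ^-congˡ; ^-assocʳ)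
  open Algebra.Properties.CommutativeSemiring.Exp commutativeSemiring using (^-distrib-*)
  open Algebra.Properties.Semiring.Mult semiring using (_×_; ×-congʳ; ×1-homo-*)
  open Algebra.Properties.CommutativeMonoid.Mult +-commutativeMonoid using (×-distrib-+)
  open Relation.Binary.Reasoning.Setoid setoid
  open Solver using (solve; _:=_; _:+_; _:*_; con)

  cancel : ∀ c {p q} → p ≈ q → c * (p + q) ≈ 0#
  cancel c p≈q = trans (*-congˡ (x≈y⇒x+y≈0 p≈q)) (zeroʳ c)

  -- In characteristic 2 an equation follows from hypotheses as soon as `P + Q` is a linear
  -- combination of the sums `p + q`. The coefficients are the certificate, and the solver checks
  -- the resulting polynomial identity. The next two lemmas do the same for more hypotheses.
  combine₁ : ∀ {P Q p q} c → p ≈ q → P + Q ≈ c * (p + q) → P ≈ Q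
  combine₁ c p≈q eq = x+y≈0⇒x≈y (trans eq (cancel c p≈q))

  combine₂ : ∀ {P Q p q p′ q′} c c′ → p ≈ q → p′ ≈ q′ →
             P + Q ≈ c * (p + q) + c′ * (p′ + q′) → P ≈ Q
  combine₂ c c′ e e′ eq = x+y≈0⇒x≈y (trans eq
    (trans (+-cong (cancel c e) (cancel c′ e′)) (+-identityˡ 0#)))

  combine₃ : ∀ {P Q p q p′ q′ p″ q″} c c′ c″ → p ≈ q → p′ ≈ q′ → p″ ≈ q″ →
             P + Q ≈ c * (p + q) + c′ * (p′ + q′) + c″ * (p″ + q″) → P ≈ Q
  combine₃ c c′ c″ e e′ e″ eq = x+y≈0⇒x≈y (trans eq
    (trans (+-cong (trans (+-cong (cancel c e) (cancel c′ e′)) (+-identityˡ 0#)) (cancel c″ e″)) (+-identityˡ 0#)))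

  integral : ∀ {x y} → x * y ≈ 0# → x ≈ 0# ⊎ y ≈ 0#
  integral {x} {y} xy≈0 with x ≟ 0# | y ≟ 0#
  ... | yes x≈0 | _       = inj₁ x≈0
  ... | no _    | yes y≈0 = inj₂ y≈0
  ... | no x≉0  | no y≉0  = contradiction xy≈0 (*-nonzero x≉0 y≉0)

  idempotent : ∀ {x} → x * x ≈ x → x ≈ 0# ⊎ x ≈ 1#
  idempotent {x} x²≈x with integral {x} {x + 1#}
    (combine₁ 1# x²≈x (solve 1 (λ x → x :* (x :+ con true) :+ con false := con true :* (x :* x :+ x)) refl x))
  ... | inj₁ x≈0   = inj₁ x≈0
  ... | inj₂ x+1≈0 = inj₂ (x+y≈0⇒x≈y x+1≈0)

  record IsAdditive (f : Carrier → Carrier) : Set (c Level.⊔ ℓ) where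
    field
      cong : ∀ {x y} → x ≈ y → f x ≈ f y
      homo : ∀ x y → f (x + y) ≈ f x + f y

    0-homo : f 0# ≈ 0#
    0-homo = combine₁ 1# (trans (sym (homo 0# 0#)) (cong (+-identityˡ 0#)))
      (solve 1 (λ a → a :+ con false := con true :* ((a :+ a) :+ a)) refl (f 0#))

    ×-homo : ∀ n x → f (n × x) ≈ n × f x
    ×-homo zero    x = 0-homo
    ×-homo (suc n) x = trans (homo x (n × x)) (+-congˡ (×-homo n x))

  φ T S : Carrier → Carrier
  φ x = x ^ (2 ℕ.^ k)
  T = powerSum 2 m
  S = powerSum (2 ℕ.^ k) r

  φ-additive : IsAdditive φ
  φ-additive = record { cong = ^-congˡ (2 ℕ.^ k) ; homo = 2^-additive k }
  T-additive : IsAdditive T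
  T-additive = record { cong = powerSum-cong 2 m ; homo = powerSum-+ 1 m }
  S-additive : IsAdditive S
  S-additive = record { cong = powerSum-cong (2 ℕ.^ k) r ; homo = powerSum-+ k r }

  module φ = IsAdditive φ-additive
  module T = IsAdditive T-additive
  module S = IsAdditive S-additive

  φ-* : ∀ x y → φ (x * y) ≈ φ x * φ y
  φ-* x y = ^-distrib-* x y (2 ℕ.^ k)

  φ-1 : φ 1# ≈ 1#
  φ-1 = 1^ (2 ℕ.^ k)

  φ≈0 : ∀ {x} → φ x ≈ 0# → x ≈ 0#
  φ≈0 {x} = go (2 ℕ.^ k)
    where
    go : ∀ n → x ^ n ≈ 0# → x ≈ 0#
    go zero    1≈0 = contradiction (sym 1≈0) 0≉1
    go (suc n) eq with integral eq
    ... | inj₁ x≈0 = x≈0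
    ... | inj₂ xⁿ≈0 = go n xⁿ≈0

  -- Since k r ≡ 1 (mod m), squaring is the r-th iterate of φ.
  φʳ≈square : ∀ x → x ^ ((2 ℕ.^ k) ℕ.^ r) ≈ x * x
  φʳ≈square x = begin
    x ^ ((2 ℕ.^ k) ℕ.^ r)           ≡⟨ ≡.cong (x ^_) (ℕₚ.^-*-assoc 2 k r) ⟩
    x ^ (2 ℕ.^ (k ℕ.* r))           ≡⟨ ≡.cong (λ e → x ^ (2 ℕ.^ e)) kr≡1+tm ⟩
    x ^ (2 ℕ.* 2 ℕ.^ (t ℕ.* m))     ≈⟨ ^-assocʳ x 2 (2 ℕ.^ (t ℕ.* m)) ⟨
    (x ^ 2) ^ (2 ℕ.^ (t ℕ.* m))     ≈⟨ go t (x ^ 2) ⟩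
    x ^ 2                           ≈⟨ *-congˡ (*-identityʳ x) ⟩
    x * x                           ∎
    where
    go : ∀ t x → x ^ (2 ℕ.^ (t ℕ.* m)) ≈ x
    go zero    x = *-identityʳ x
    go (suc t) x = begin
      x ^ (2 ℕ.^ (m ℕ.+ t ℕ.* m))           ≡⟨ ≡.cong (x ^_) (ℕₚ.^-distribˡ-+-* 2 m (t ℕ.* m)) ⟩
      x ^ (2 ℕ.^ m ℕ.* 2 ℕ.^ (t ℕ.* m))     ≈⟨ ^-assocʳ x (2 ℕ.^ m) (2 ℕ.^ (t ℕ.* m)) ⟨
      (x ^ (2 ℕ.^ m)) ^ (2 ℕ.^ (t ℕ.* m))   ≈⟨ ^-congˡ (2 ℕ.^ (t ℕ.* m)) (x^2^m≈x x) ⟩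
      x ^ (2 ℕ.^ (t ℕ.* m))                 ≈⟨ go t x ⟩
      x                                     ∎

  -- A fixed point of `φ` is fixed by its `r`-th iterate, which is squaring, and is therefore
  -- idempotent.
  φ-fixed : ∀ {x} → φ x ≈ x → x ≈ 0# ⊎ x ≈ 1#
  φ-fixed {x} φx≈x = idempotent (trans (sym (φʳ≈square x)) (go r))
    where
    go : ∀ n → x ^ ((2 ℕ.^ k) ℕ.^ n) ≈ x
    go zero    = *-identityʳ x
    go (suc n) = trans (sym (^-assocʳ x (2 ℕ.^ k) ((2 ℕ.^ k) ℕ.^ n))) (trans (^-congˡ ((2 ℕ.^ k) ℕ.^ n) φx≈x) (go n))

  -- The hypothesis says, with denominators cleared, that `p / q` is fixed by `φ`; hence the
  -- quotient is 0 or 1.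
  φ-fixed-ratio : ∀ {p q} → q ≉ 0# → p * φ q ≈ φ p * q → p ≈ 0# ⊎ p ≈ q
  φ-fixed-ratio {p} {q} q≉0 pφq≈φpq = Sum.map p≈0 p≈q (φ-fixed φ-fixes)
    where
    j = proj₁ (invertible q≉0)
    q*j≈1 : q * j ≈ 1#
    q*j≈1 = proj₂ (proj₂ (invertible q≉0))
    φ-fixes : φ (p * j) ≈ p * j
    φ-fixes = trans (φ-* p j) (combine₃ (φ j * j) (φ p * φ j) (p * j)
      pφq≈φpq q*j≈1 (trans (sym (φ-* q j)) (trans (φ.cong q*j≈1) φ-1))
      (solve 6 (λ p φp q φq j φj → φp :* φj :+ p :* j :=
          φj :* j :* (p :* φq :+ φp :* q) :+ φp :* φj :* (q :* j :+ con true) :+ p :* j :* (φq :* φj :+ con true))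
        refl p (φ p) q (φ q) j (φ j)))
    p≈0 : p * j ≈ 0# → p ≈ 0#
    p≈0 pj≈0 = combine₂ q p pj≈0 q*j≈1
      (solve 3 (λ p q j → p :+ con false := q :* (p :* j :+ con false) :+ p :* (q :* j :+ con true)) refl p q j)
    p≈q : p * j ≈ 1# → p ≈ q
    p≈q pj≈1 = combine₂ q p pj≈1 q*j≈1
      (solve 3 (λ p q j → p :+ q := q :* (p :* j :+ con true) :+ p :* (q :* j :+ con true)) refl p q j)

  -- In the field `n × 1#` is the parity of `n`, so the image of `k r = 1 + t m` would read 0 = 1.
  m,r-not-both-even : m × 1# ≈ 0# → ¬ (r × 1# ≈ 0#)
  m,r-not-both-even m≈0 r≈0 = 0≉1 (begin
    0#                                  ≈⟨ zeroʳ _ ⟨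
    (k × 1#) * 0#                       ≈⟨ *-congˡ r≈0 ⟨
    (k × 1#) * (r × 1#)                 ≈⟨ ×1-homo-* k r ⟨
    (k ℕ.* r) × 1#                      ≡⟨ ≡.cong (_× 1#) kr≡1+tm ⟩
    1# + (t ℕ.* m) × 1#                 ≈⟨ +-congˡ (×1-homo-* t m) ⟩
    1# + (t × 1#) * (m × 1#)            ≈⟨ +-congˡ (trans (*-congˡ m≈0) (zeroʳ _)) ⟩
    1# + 0#                             ≈⟨ +-identityʳ 1# ⟩
    1#                                  ∎)

  -- For one squaring the trace telescopes to `x + x ^ (2 ^ m)`, which is 0; the general case
  -- iterates this.
  T-^2^ : ∀ j x → T (x ^ (2 ℕ.^ j)) ≈ T x
  T-^2^ zero    x = T.cong (*-identityʳ x)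
  T-^2^ (suc j) x = begin
    T (x ^ (2 ℕ.* 2 ℕ.^ j))    ≈⟨ T.cong (^-assocʳ x 2 (2 ℕ.^ j)) ⟨
    T ((x ^ 2) ^ (2 ℕ.^ j))    ≈⟨ T-^2^ j (x ^ 2) ⟩
    T (x ^ 2)                  ≈⟨ combine₂ 1# 1# (powerSum-telescopes 2 m x) (x^2^m≈x x)
                                   (solve 4 (λ a b x y → a :+ b := con true :* ((a :+ x) :+ (b :+ y)) :+ con true :* (y :+ x))
                                     refl (T (x ^ 2)) (T x) x (x ^ (2 ℕ.^ m))) ⟩
    T x                        ∎

  T-idempotent : ∀ x → T x * T x ≈ T x
  T-idempotent x = begin
    T x * T x   ≈⟨ *-congˡ (*-identityʳ _) ⟨
    T x ^ 2     ≈⟨ powerSum-^ 1 2 m x ⟩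
    T (x ^ 2)   ≈⟨ T-^2^ 1 x ⟩
    T x         ∎

  -- Every term is a Frobenius power of `x` and so has the trace of `x`.
  T-powerSum : ∀ j n x → T (powerSum (2 ℕ.^ j) n x) ≈ n × T x
  T-powerSum j zero    x = T.0-homo
  T-powerSum j (suc n) x = trans (T.homo x _)
    (+-congˡ (trans (T-powerSum j n (x ^ (2 ℕ.^ j))) (×-congʳ n (T-^2^ j x))))

  module _ (α : ℕ) where

    L : Carrier → Carrier
    L x = α × T x + S x

    L-additive : IsAdditive L
    L-additive = record
      { cong = λ x≈y → +-cong (×-congʳ α (T.cong x≈y)) (S.cong x≈y)
      ; homo = λ x y → begin
          α × T (x + y) + S (x + y)                ≈⟨ +-cong (×-congʳ α (T.homo x y)) (S.homo x y) ⟩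
          α × (T x + T y) + (S x + S y)            ≈⟨ +-congʳ (×-distrib-+ (T x) (T y) α) ⟩
          (α × T x + α × T y) + (S x + S y)
            ≈⟨ solve 4 (λ a b c d → (a :+ b) :+ (c :+ d) := (a :+ c) :+ (b :+ d)) refl _ _ _ _ ⟩
          L x + L y                                ∎
      }
    module L = IsAdditive L-additive

    -- The `α` terms cancel because `T` is invariant under `φ`, and `S` telescopes to `x` plus its
    -- image under the `r`-th iterate of `φ`.
    L-φ : ∀ x → L (φ x) + L x ≈ x * x + x
    L-φ x = combine₃ 1# 1# 1# (×-congʳ α (T-^2^ k x)) (powerSum-telescopes (2 ℕ.^ k) r x) (φʳ≈square x)
      (solve 7 (λ α×Tφx α×Tx Sφx Sx x x² x^ →
          (α×Tφx :+ Sφx) :+ (α×Tx :+ Sx) :+ (x² :+ x) :=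
          con true :* (α×Tφx :+ α×Tx) :+ con true :* ((Sφx :+ x) :+ (Sx :+ x^)) :+ con true :* (x^ :+ x²))
        refl (α × T (φ x)) (α × T x) (S (φ x)) (S x) x (x * x) (x ^ ((2 ℕ.^ k) ℕ.^ r)))

    φ-L : ∀ x → φ (L x) ≈ L (φ x)
    φ-L x = begin
      φ (α × T x + S x)             ≈⟨ φ.homo _ _ ⟩
      φ (α × T x) + φ (S x)         ≈⟨ +-congʳ (φ.×-homo α (T x)) ⟩
      α × φ (T x) + φ (S x)         ≈⟨ +-cong (×-congʳ α (powerSum-^ k 2 m x)) (powerSum-^ k (2 ℕ.^ k) r x) ⟩
      α × T (φ x) + S (φ x)         ∎

    φL+L : ∀ x → φ (L x) + L x ≈ x * x + x
    φL+L x = trans (+-congʳ (φ-L x)) (L-φ x)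

    -- If `L z` vanishes then `φL+L` gives `z² + z = 0`, so `z` is 0 or 1. At `z = 1` the two
    -- hypotheses would make `m` and `r` both even.
    L-kernel : ∀ {z} → T z ≈ 0# → L z ≈ 0# → z ≈ 0#
    L-kernel {z} Tz≈0 Lz≈0 = [ id , (λ z≈1 → contradiction (r≈0 z≈1) (m,r-not-both-even (m≈0 z≈1))) ]′ (idempotent z²≈z)
      where
      zeros : ∀ n → n × 0# ≈ 0#
      zeros zero    = refl
      zeros (suc n) = trans (+-identityˡ _) (zeros n)
      z²≈z : z * z ≈ z
      z²≈z = combine₃ 1# 1# 1# (φL+L z) Lz≈0 (trans (φ.cong Lz≈0) φ.0-homo)
        (solve 4 (λ φL L z z² → z² :+ z :=
            con true :* ((φL :+ L) :+ (z² :+ z)) :+ con true :* (L :+ con false) :+ con true :* (φL :+ con false))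
          refl (φ (L z)) (L z) z (z * z))
      m≈0 : z ≈ 1# → m × 1# ≈ 0#
      m≈0 z≈1 = trans (sym (powerSum-1 2 m)) (trans (T.cong (sym z≈1)) Tz≈0)
      r≈0 : z ≈ 1# → r × 1# ≈ 0#
      r≈0 z≈1 = begin
        r × 1#             ≈⟨ powerSum-1 (2 ℕ.^ k) r ⟨
        S 1#               ≈⟨ S.cong z≈1 ⟨
        S z                ≈⟨ +-identityˡ _ ⟨
        0# + S z           ≈⟨ +-congʳ (zeros α) ⟨
        α × 0# + S z       ≈⟨ +-congʳ (×-congʳ α Tz≈0) ⟨
        α × T z + S z      ≈⟨ Lz≈0 ⟩
        0#                 ∎

    -- u = y / x and w = φ y / x, where y = L x.
    record Factorisation (x h : Carrier) : Set (c Level.⊔ ℓ) where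
      field
        u w   : Carrier
        u*w≈h : u * w ≈ h
        u+w   : u + w ≈ x + 1#
        u*x   : u * x ≈ L x
        w*x   : w * x ≈ φ (L x)

      -- By their sum and product, `u` and `w` are the roots of `z² + (x + 1) z + h`; the term `x z`
      -- is then known from `u*x` or `w*x`.
      u²+u : u * u + u + h ≈ L x
      u²+u = combine₃ u 1# 1# u+w u*w≈h u*x
        (solve 5 (λ u w h x y → u :* u :+ u :+ h :+ y :=
          u :* ((u :+ w) :+ (x :+ con true)) :+ con true :* (u :* w :+ h) :+ con true :* (u :* x :+ y))
          refl u w h x (L x))

      w²+w : w * w + w + h ≈ φ (L x)
      w²+w = combine₃ w 1# 1# u+w u*w≈h w*x
        (solve 5 (λ u w h x y → w :* w :+ w :+ h :+ y :=
          w :* ((u :+ w) :+ (x :+ con true)) :+ con true :* (u :* w :+ h) :+ con true :* (w :* x :+ y))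
          refl u w h x (φ (L x)))

      u²*φL : u * u * φ (L x) ≈ h * L x
      u²*φL = combine₃ (u * u) (u * x) h w*x u*w≈h u*x
        (solve 6 (λ u w h x y y₁ → u :* u :* y₁ :+ h :* y :=
          u :* u :* (w :* x :+ y₁) :+ u :* x :* (u :* w :+ h) :+ h :* (u :* x :+ y))
          refl u w h x (L x) (φ (L x)))

    -- The value `h` is known only through its equation, so that two arguments with equal values can
    -- share the same `h`. The sum `u + w` is `(x² + x) / x` by `φL+L`.
    factorise : ∀ {x h} → x ≉ 0# → x * x * h ≈ φ (L x) * L x → Factorisation x h
    factorise {x} {h} x≉0 x²h≈φL*L = record
      { u = L x * i
      ; w = φ (L x) * i
      ; u*w≈h = combine₂ (i * i) (h * (x * i + 1#)) x²h≈φL*L x*i≈1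
          (solve 5 (λ y y₁ x i h → y :* i :* (y₁ :* i) :+ h :=
            i :* i :* (x :* x :* h :+ y₁ :* y) :+ h :* (x :* i :+ con true) :* (x :* i :+ con true))
            refl (L x) (φ (L x)) x i h)
      ; u+w = combine₂ i (x + 1#) (φL+L x) x*i≈1
          (solve 4 (λ y y₁ x i → y :* i :+ y₁ :* i :+ (x :+ con true) :=
            i :* ((y₁ :+ y) :+ (x :* x :+ x)) :+ (x :+ con true) :* (x :* i :+ con true))
            refl (L x) (φ (L x)) x i)
      ; u*x = *i*x (L x)
      ; w*x = *i*x (φ (L x))
      }
      where
      i = proj₁ (invertible x≉0)
      x*i≈1 : x * i ≈ 1#
      x*i≈1 = proj₂ (proj₂ (invertible x≉0))
      *i*x : ∀ y → y * i * x ≈ y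
      *i*x y = combine₁ y x*i≈1
        (solve 3 (λ x i y → y :* i :* x :+ y := y :* (x :* i :+ con true)) refl x i y)

    -- Two arguments with a common value `h`.

    module _ {x x′ h : Carrier} (F : Factorisation x h) (F′ : Factorisation x′ h) where
      private
        module F = Factorisation F
        module F′ = Factorisation F′
        y  = L x
        y′ = L x′
        d = F.u + F′.u
        e = F.w + F′.w

      d²+d : d * d + d ≈ y + y′
      d²+d = combine₂ 1# 1# F.u²+u F′.u²+u
        (solve 5 (λ u u′ h y y′ → (u :+ u′) :* (u :+ u′) :+ (u :+ u′) :+ (y :+ y′) :=
          con true :* (u :* u :+ u :+ h :+ y) :+ con true :* (u′ :* u′ :+ u′ :+ h :+ y′))
          refl F.u F′.u h y y′)

      e²+e : e * e + e ≈ φ y + φ y′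
      e²+e = combine₂ 1# 1# F.w²+w F′.w²+w
        (solve 5 (λ u u′ h y y′ → (u :+ u′) :* (u :+ u′) :+ (u :+ u′) :+ (y :+ y′) :=
          con true :* (u :* u :+ u :+ h :+ y) :+ con true :* (u′ :* u′ :+ u′ :+ h :+ y′))
          refl F.w F′.w h (φ y) (φ y′))

      x+x′≈d+e : x + x′ ≈ d + e
      x+x′≈d+e = combine₂ 1# 1# F.u+w F′.u+w
        (solve 6 (λ u u′ w w′ x x′ → x :+ x′ :+ ((u :+ u′) :+ (w :+ w′)) :=
          con true :* ((u :+ w) :+ (x :+ con true)) :+ con true :* ((u′ :+ w′) :+ (x′ :+ con true)))
          refl F.u F′.u F.w F′.w x x′)

      -- Both `e` and `φ d` solve `z² + z = φ y + φ y′`, so they differ by 0 or 1. A difference of 1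
      -- would put 1 into the common kernel of `T` and `L`.
      e≈φd : T x ≈ T x′ → e ≈ φ d
      e≈φd Tx≈Tx′ =
        [ x+y≈0⇒x≈y , (λ ε≈1 → contradiction (L-kernel (T1≈0 ε≈1) (L1≈0 ε≈1)) (0≉1 ∘ sym)) ]′ (idempotent ε²≈ε)
        where
        φd²+φd : φ d * φ d + φ d ≈ φ y + φ y′
        φd²+φd = begin
          φ d * φ d + φ d     ≈⟨ +-congʳ (φ-* d d) ⟨
          φ (d * d) + φ d     ≈⟨ φ.homo (d * d) d ⟨
          φ (d * d + d)       ≈⟨ φ.cong d²+d ⟩
          φ (y + y′)          ≈⟨ φ.homo y y′ ⟩
          φ y + φ y′          ∎
        ε²≈ε : (e + φ d) * (e + φ d) ≈ e + φ d
        ε²≈ε = combine₂ 1# 1# e²+e φd²+φd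
          (solve 4 (λ e f y y′ → (e :+ f) :* (e :+ f) :+ (e :+ f) :=
            con true :* (e :* e :+ e :+ (y :+ y′)) :+ con true :* (f :* f :+ f :+ (y :+ y′)))
            refl e (φ d) (φ y) (φ y′))
        x+x′≈ : e + φ d ≈ 1# → x + x′ ≈ (φ d + d) + 1#
        x+x′≈ e+φd≈1 = combine₂ 1# 1# x+x′≈d+e e+φd≈1
          (solve 5 (λ d e f x x′ → x :+ x′ :+ ((f :+ d) :+ con true) :=
            con true :* ((x :+ x′) :+ (d :+ e)) :+ con true :* ((e :+ f) :+ con true)) refl d e (φ d) x x′)
        -- Apply `T` to `x+x′≈`: the traces of `x` and `x′` cancel, and so do those of `φ d` and
        -- `d`.
        T1≈0 : e + φ d ≈ 1# → T 1# ≈ 0#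
        T1≈0 ε≈1 = combine₃ 1# 1# 1#
          (trans (sym (T.homo x x′)) (trans (T.cong (x+x′≈ ε≈1)) (trans (T.homo _ 1#) (+-congʳ (T.homo _ d)))))
          Tx≈Tx′ (T-^2^ k d)
          (solve 5 (λ a b p q o → o :+ con false :=
              con true :* (a :+ b :+ ((p :+ q) :+ o)) :+ con true :* (a :+ b) :+ con true :* (p :+ q))
            refl (T x) (T x′) (T (φ d)) (T d) (T 1#))
        -- Apply `L` to `x+x′≈`: `L (φ d) + L d` is `d² + d`, which equals `y + y′` and cancels the
        -- left side.
        L1≈0 : e + φ d ≈ 1# → L 1# ≈ 0#
        L1≈0 ε≈1 = combine₃ 1# 1# 1#
          (trans (sym (L.homo x x′)) (trans (L.cong (x+x′≈ ε≈1)) (trans (L.homo _ 1#) (+-congʳ (L.homo _ d)))))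
          d²+d (L-φ d)
          (solve 6 (λ a b p q o d → o :+ con false :=
              con true :* (a :+ b :+ ((p :+ q) :+ o)) :+ con true :* (d :* d :+ d :+ (a :+ b)) :+ con true :* (p :+ q :+ (d :* d :+ d)))
            refl y y′ (L (φ d)) (L d) (L 1#) d)

      d²/yy′≈e²/φyφy′ : (d * d) * (φ y * φ y′) ≈ (e * e) * (y * y′)
      d²/yy′≈e²/φyφy′ = begin
        (d * d) * (φ y * φ y′)
          ≈⟨ *-congˡ (*-cong F.w*x F′.w*x) ⟨
        (d * d) * (F.w * x * (F′.w * x′))
          -- The two sides differ by `x x′ (u w′ + u′ w) (u w + u′ w′)`, and both products in the
          -- last factor are `h`.
          ≈⟨ combine₂ coef coef F.u*w≈h F′.u*w≈h
               (solve 7 (λ u u′ w w′ x x′ h →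
                 (u :+ u′) :* (u :+ u′) :* (w :* x :* (w′ :* x′)) :+ (w :+ w′) :* (w :+ w′) :* (u :* x :* (u′ :* x′)) :=
                 x :* x′ :* (u :* w′ :+ u′ :* w) :* (u :* w :+ h) :+
                 x :* x′ :* (u :* w′ :+ u′ :* w) :* (u′ :* w′ :+ h))
               refl F.u F′.u F.w F′.w x x′ h) ⟩
        (e * e) * (F.u * x * (F′.u * x′))
          ≈⟨ *-congˡ (*-cong F.u*x F′.u*x) ⟩
        (e * e) * (y * y′) ∎
        where coef = x * x′ * (F.u * F′.w + F′.u * F.w)

      -- In this case v = y / y′ + y solves φ v + v = x and v² + v + 1 = y = L x,
      -- against L (φ v + v) = v² + v.
      d²≉yy′ : x ≉ 0# → y ≉ 0# → y′ ≉ 0# → x * x * h ≈ φ y * y → ¬ (d * d ≈ y * y′)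
      d²≉yy′ x≉0 y≉0 y′≉0 x²h d²≈yy′ = 0≉1 (sym (combine₃ 1# 1# 1#
        (trans (sym (L.homo (φ v) v)) (L.cong φv+v≈x)) (L-φ v) v²+v+1≈y
        (solve 4 (λ v y a b → con true :+ con false :=
            con true :* (a :+ b :+ y) :+ con true :* (a :+ b :+ (v :* v :+ v)) :+ con true :* (v :* v :+ v :+ con true :+ y))
          refl v y (L (φ v)) (L v))))
        where
        j = proj₁ (invertible y′≉0)
        y′*j≈1 : y′ * j ≈ 1#
        y′*j≈1 = proj₂ (proj₂ (invertible y′≉0))
        φy′*φj≈1 : φ y′ * φ j ≈ 1#
        φy′*φj≈1 = trans (sym (φ-* y′ j)) (trans (φ.cong y′*j≈1) φ-1)
        v = y * j + y
        -- Here `D` is zero, by `d² = y y′` and `d²+d`. Squaring `d = y + y′ + y y′` then eliminates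
        -- `d` from `yy′≈`.
        D = d + y + y′ + y * y′
        yy′≈ : (y + y′) * (y + y′) + y * y′ * (y * y′) ≈ y * y′
        yy′≈ = combine₂ (D + 1#) D d²≈yy′ d²+d
          (solve 3 (λ d y y′ → (y :+ y′) :* (y :+ y′) :+ y :* y′ :* (y :* y′) :+ y :* y′ :=
              ((d :+ y :+ y′ :+ y :* y′) :+ con true) :* (d :* d :+ y :* y′) :+
              (d :+ y :+ y′ :+ y :* y′) :* (d :* d :+ d :+ (y :+ y′)))
            refl d y y′)
        -- Divide `yy′≈` by `y′²`, with `j` as the inverse of `y′`.
        v²+v+1≈y : v * v + v + 1# ≈ y
        v²+v+1≈y = combine₂ (j * j) ((1# + y * y) * (y′ * j + 1#) + j * y) yy′≈ y′*j≈1
          (solve 3 (λ y y′ j → (y :* j :+ y) :* (y :* j :+ y) :+ (y :* j :+ y) :+ con true :+ y :=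
              j :* j :* ((y :+ y′) :* (y :+ y′) :+ y :* y′ :* (y :* y′) :+ y :* y′) :+
              ((con true :+ y :* y) :* (y′ :* j :+ con true) :+ j :* y) :* (y′ :* j :+ con true))
            refl y y′ j)
        -- Multiply `d² = y y′` by `φ y φ y′`, expand `d²` as `u² + u′²`, and use `u²*φL` for both
        -- arguments.
        yy′φyφy′≈ : y * y′ * (φ y * φ y′) ≈ h * (y * φ y′ + y′ * φ y)
        yy′φyφy′≈ = combine₃ (φ y * φ y′) (φ y′) (φ y) d²≈yy′ F.u²*φL F′.u²*φL
          (solve 7 (λ u u′ y y′ z z′ h → y :* y′ :* (z :* z′) :+ h :* (y :* z′ :+ y′ :* z) :=
              z :* z′ :* ((u :+ u′) :* (u :+ u′) :+ y :* y′) :+ z′ :* (u :* u :* z :+ h :* y) :+ z :* (u′ :* u′ :* z′ :+ h :* y′))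
            refl F.u F′.u y y′ (φ y) (φ y′) h)
        -- Multiply by `x²`, replace `x² h` by `φ y y`, and cancel the nonzero factor `y φ y`.
        x²y′φy′≈ : x * x * (y′ * φ y′) ≈ y * φ y′ + y′ * φ y
        x²y′φy′≈ = *-cancelʳ (*-nonzero y≉0 (y≉0 ∘ φ≈0)) (combine₂ (x * x) (y * φ y′ + y′ * φ y) yy′φyφy′≈ x²h
          (solve 6 (λ x y y′ z z′ h → x :* x :* (y′ :* z′) :* (y :* z) :+ (y :* z′ :+ y′ :* z) :* (y :* z) :=
              x :* x :* (y :* y′ :* (z :* z′) :+ h :* (y :* z′ :+ y′ :* z)) :+ (y :* z′ :+ y′ :* z) :* (x :* x :* h :+ z :* y))
            refl x y y′ (φ y) (φ y′) h))
        φv≈ : φ v ≈ φ y * φ j + φ y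
        φv≈ = trans (φ.homo (y * j) y) (+-congʳ (φ-* y j))
        -- Dividing by `y′ φ y′` gives `φ (y / y′) + y / y′ = x²`; adding `φ y + y = x² + x` then
        -- leaves `φ v + v = x`.
        x²≈ : φ y * φ j + y * j ≈ x * x
        x²≈ = combine₃ (j * φ j) (x * x * (φ y′ * φ j) + φ j * φ y) (x * x + j * y) x²y′φy′≈ y′*j≈1 φy′*φj≈1
          (solve 7 (λ x y y′ z z′ j f → z :* f :+ y :* j :+ x :* x :=
              j :* f :* (x :* x :* (y′ :* z′) :+ (y :* z′ :+ y′ :* z)) :+
              (x :* x :* (z′ :* f) :+ f :* z) :* (y′ :* j :+ con true) :+
              (x :* x :+ j :* y) :* (z′ :* f :+ con true))
            refl x y y′ (φ y) (φ y′) j (φ j))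
        φv+v≈x : φ v + v ≈ x
        φv+v≈x = combine₃ 1# 1# 1# φv≈ x²≈ (φL+L x)
          (solve 6 (λ f x y z a b → f :+ (b :+ y) :+ x :=
              con true :* (f :+ (a :+ z)) :+ con true :* (a :+ b :+ x :* x) :+ con true :* (z :+ y :+ (x :* x :+ x)))
            refl (φ v) x y (φ y) (φ y * φ j) (y * j))

      factorisation-injective : x ≉ 0# → y ≉ 0# → y′ ≉ 0# → x * x * h ≈ φ y * y → T x ≈ T x′ → x ≈ x′
      factorisation-injective x≉0 y≉0 y′≉0 x²h Tx≈Tx′ =
        [ d²≈0⇒x≈x′ , (λ d²≈yy′ → contradiction d²≈yy′ (d²≉yy′ x≉0 y≉0 y′≉0 x²h)) ]′
          (φ-fixed-ratio (*-nonzero y≉0 y′≉0) ratio)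
        where
        -- With `e = φ d` the relation says that `d² / (y y′)` is fixed by `φ`.
        ratio : (d * d) * φ (y * y′) ≈ φ (d * d) * (y * y′)
        ratio = begin
          (d * d) * φ (y * y′)     ≈⟨ *-congˡ (φ-* y y′) ⟩
          (d * d) * (φ y * φ y′)   ≈⟨ d²/yy′≈e²/φyφy′ ⟩
          (e * e) * (y * y′)       ≈⟨ *-congʳ (*-cong (e≈φd Tx≈Tx′) (e≈φd Tx≈Tx′)) ⟩
          (φ d * φ d) * (y * y′)   ≈⟨ *-congʳ (φ-* d d) ⟨
          φ (d * d) * (y * y′)     ∎
        d²≈0⇒x≈x′ : d * d ≈ 0# → x ≈ x′
        d²≈0⇒x≈x′ d²≈0 = x+y≈0⇒x≈y (begin
          x + x′     ≈⟨ x+x′≈d+e ⟩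
          d + e      ≈⟨ +-congˡ (e≈φd Tx≈Tx′) ⟩
          d + φ d    ≈⟨ +-cong d≈0 (trans (φ.cong d≈0) φ.0-homo) ⟩
          0# + 0#    ≈⟨ +-identityˡ 0# ⟩
          0#         ∎)
          where
          d≈0 : d ≈ 0#
          d≈0 = [ id , id ]′ (integral d²≈0)

-- The order of vanishing of the numerator at zero.

numerator-vanishes : ∀ m k r α γ → Polynomial.Vanishes F₂ (2 ℕ.^ k ℕ.+ 1) (numerator m k r α γ)
numerator-vanishes m k r α γ = vanishes-^ (base m k r α γ)
  (vanishes-+ (toℕ α × Tr m) _
    (vanishes-× (toℕ α) (Tr m)
      (vanishes-sum {n = m} _ λ i → vanishes-X^ _ {{ℕₚ.m^n≢0 2 (toℕ i)}}))
    (vanishes-sum {n = r} _ λ i →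
      vanishes-X^ _ {{ℕₚ.m^n≢0 (2 ℕ.^ k) (toℕ i) {{ℕₚ.m^n≢0 2 k}}}}))
  (2 ℕ.^ k ℕ.+ 1)
  where open Polynomial F₂

vanishes-/X² : ∀ {n} p → Polynomial.Vanishes F₂ (2 ℕ.+ n) p → Polynomial.Vanishes F₂ n (Polynomial._/X² F₂ p)
vanishes-/X² []          v i i<n = ≡.refl
vanishes-/X² (a ∷ [])    v i i<n = ≡.refl
vanishes-/X² (a ∷ b ∷ p) v i i<n = v (suc (suc i)) (s≤s (s≤s i<n))

-- Order 2 makes the division by X² exact; the third order, available because `k` is positive, makes
-- the quotient vanish at zero.
3≤2^k+1 : ∀ k .{{_ : NonZero k}} → 3 ℕ.≤ 2 ℕ.^ k ℕ.+ 1
3≤2^k+1 k = ℕₚ.+-monoˡ-≤ 1 (ℕₚ.^-monoʳ-≤ 2 (ℕ.>-nonZero⁻¹ k))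

-- The map induced by `H` on the trace classes.

module Mapping {c ℓ} (𝔽 : Field c ℓ) {n : ℕ} (enum : HasOrder 𝔽 n) (1+1≈0 : HasCharacteristic2 𝔽)
  (m k r t : ℕ) .{{_ : NonZero k}} (x^2^m≈x : FixedByPower 𝔽 (2 ℕ.^ m)) (kr≡1+tm : k ℕ.* r ≡ 1 ℕ.+ t ℕ.* m)
  (α γ : Fin 2)
  where

  open Field 𝔽 hiding (zero)
  open FieldProperties 𝔽
  open FiniteSetoid setoid enum using (_≟_; glued-surjective)
  open CharacteristicTwo 𝔽 1+1≈0
  open Injectivity 𝔽 _≟_ 1+1≈0 m k r t x^2^m≈x kr≡1+tm hiding (L; module L)
  open Algebra.Properties.Semiring.Exp semiring using (_^_; ^-congˡ; ^-homo-*)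
  open Algebra.Properties.Semiring.Mult semiring using (_×_; ×-congʳ; ×-homo-+; ×-assocˡ; ×1-homo-*; ×-assoc-*; ×-homo-1)
  open Relation.Binary.Reasoning.Setoid setoid
  open Solver using (solve; _:=_; _:+_; _:*_; con)
  open Over 𝔽 using (𝐓; ⟦_⟧; baseChange; IsPermutationPolynomial)

  a g s : ℕ
  a = toℕ α
  g = toℕ γ
  s = r ℕ.+ (a ℕ.+ g) ℕ.* m

  L h K : Carrier → Carrier
  L = Injectivity.L 𝔽 _≟_ 1+1≈0 m k r t x^2^m≈x kr≡1+tm a
  h = ⟦ baseChange (H m k r α γ) ⟧
  K x = eval x (Polynomial._/X² F₂ (numerator m k r α γ))

  module L = IsAdditive (L-additive a)

  eval-Tr : ∀ x → eval x (Tr m) ≈ T x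
  eval-Tr = eval-powerSum 2 m

  eval-base : ∀ x → eval x (base m k r α γ) ≈ L x
  eval-base x = trans (eval-+ x (Polynomial._×_ F₂ a (Tr m)) _)
    (+-cong (trans (eval-× x a (Tr m)) (×-congʳ a (eval-Tr x))) (eval-powerSum (2 ℕ.^ k) r x))

  x²K : ∀ x → x * x * K x ≈ φ (L x) * L x
  x²K x = begin
    x * x * K x                                    ≈⟨ eval-/X² x (numerator m k r α γ)
                                                       (λ i i<2 → numerator-vanishes m k r α γ i (ℕₚ.<-trans i<2 (3≤2^k+1 k))) ⟩
    eval x (numerator m k r α γ)                   ≈⟨ eval-^ x (base m k r α γ) (2 ℕ.^ k ℕ.+ 1) ⟩
    eval x (base m k r α γ) ^ (2 ℕ.^ k ℕ.+ 1)      ≈⟨ ^-congˡ (2 ℕ.^ k ℕ.+ 1) (eval-base x) ⟩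
    L x ^ (2 ℕ.^ k ℕ.+ 1)                          ≈⟨ ^-homo-* (L x) (2 ℕ.^ k) 1 ⟩
    φ (L x) * (L x * 1#)                           ≈⟨ *-congˡ (*-identityʳ (L x)) ⟩
    φ (L x) * L x                                  ∎

  K-0 : ∀ {x} → x ≈ 0# → K x ≈ 0#
  K-0 {x} = eval-vanishes x (Polynomial._/X² F₂ (numerator m k r α γ)) (vanishes-/X² {1} (numerator m k r α γ)
    (λ i i<3 → numerator-vanishes m k r α γ i (ℕₚ.<-≤-trans i<3 (3≤2^k+1 k))))

  h≈γT+K : ∀ x → h x ≈ g × T x + K x
  h≈γT+K x = trans (eval-+ x (Polynomial._×_ F₂ g (Tr m)) _)
    (+-congʳ (trans (eval-× x g (Tr m)) (×-congʳ g (eval-Tr x))))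

  L-0 : ∀ {x} → x ≈ 0# → L x ≈ 0#
  L-0 x≈0 = trans (L.cong x≈0) L.0-homo

  K≈0⇒L≈0 : ∀ {x} → K x ≈ 0# → L x ≈ 0#
  K≈0⇒L≈0 {x} Kx≈0 = [ φ≈0 , id ]′ (integral (trans (sym (x²K x)) (trans (*-congˡ Kx≈0) (zeroʳ _))))

  -- For nonzero `x` the factor `x²` cancels from `x²K`; at zero `K` vanishes by its order there.
  L≈0⇒K≈0 : ∀ {x} → L x ≈ 0# → K x ≈ 0#
  L≈0⇒K≈0 {x} Lx≈0 =
    [ (λ x²≈0 → K-0 ([ id , id ]′ (integral x²≈0))) , id ]′
      (integral (trans (x²K x) (trans (*-congˡ Lx≈0) (zeroʳ _))))

  -- For nonzero `x` the factorisation gives `u² + u + K x = L x`, and `u² + u` has trace 0.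
  T-K : ∀ x → T (K x) ≈ T (L x)
  T-K x with x ≟ 0#
  ... | yes x≈0 = T.cong (trans (K-0 x≈0) (sym (L-0 x≈0)))
  ... | no  x≉0 = combine₃ 1# 1# 1#
        (trans (sym (T.cong (Factorisation.u²+u F))) (trans (T.homo _ (K x)) (+-congʳ (T.homo _ u))))
        (T-^2^ 1 u) (T.cong (*-congˡ (*-identityʳ u)))
        (solve 5 (λ k l p q o → k :+ l :=
            con true :* (l :+ ((p :+ q) :+ k)) :+ con true :* (o :+ q) :+ con true :* (o :+ p))
          refl (T (K x)) (T (L x)) (T (u * u)) (T u) (T (u ^ 2)))
    where
    F : Factorisation a x (K x)
    F = factorise a x≉0 (x²K x)
    u = Factorisation.u F

  -- The contributions to the factor `s` are `g m` from the added trace, `a m` from the trace inside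
  -- `L`, and `r` from `S`.
  T-h : ∀ x → T (h x) ≈ s × T x
  T-h x = begin
    T (h x)                                             ≈⟨ T.cong (h≈γT+K x) ⟩
    T (g × T x + K x)                                   ≈⟨ T.homo _ _ ⟩
    T (g × T x) + T (K x)                               ≈⟨ +-cong (T-×T g) (T-K x) ⟩
    (g ℕ.* m) × T x + T (L x)                           ≈⟨ +-congˡ (T.homo _ _) ⟩
    (g ℕ.* m) × T x + (T (a × T x) + T (S x))           ≈⟨ +-congˡ (+-cong (T-×T a) (T-powerSum k r x)) ⟩
    (g ℕ.* m) × T x + ((a ℕ.* m) × T x + r × T x)
      ≈⟨ solve 3 (λ p q w → p :+ (q :+ w) := w :+ (q :+ p)) refl _ _ _ ⟩
    r × T x + ((a ℕ.* m) × T x + (g ℕ.* m) × T x)       ≈⟨ +-congˡ (×-homo-+ (T x) (a ℕ.* m) (g ℕ.* m)) ⟨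
    r × T x + (a ℕ.* m ℕ.+ g ℕ.* m) × T x               ≈⟨ ×-homo-+ (T x) r _ ⟨
    (r ℕ.+ (a ℕ.* m ℕ.+ g ℕ.* m)) × T x                 ≡⟨ ≡.cong (λ e → (r ℕ.+ e) × T x) (ℕₚ.*-distribʳ-+ m a g) ⟨
    s × T x                                             ∎
    where
    T-×T : ∀ j → T (j × T x) ≈ (j ℕ.* m) × T x
    T-×T j = trans (T.×-homo j (T x)) (trans (×-congʳ j (T-powerSum 1 m x)) (×-assocˡ (T x) j m))

  -- Equal traces cancel the `γ` terms. If `L x` vanishes, so does `L x′`, and `x + x′` lies in the
  -- common kernel of `T` and `L`; otherwise both arguments are nonzero and factorise the same
  -- value.
  h-injective : ∀ {x x′} → T x ≈ T x′ → h x ≈ h x′ → x ≈ x′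
  h-injective {x} {x′} Tx≈Tx′ hx≈hx′ = by-cases (L x ≟ 0#)
    where
    Kx≈Kx′ : K x ≈ K x′
    Kx≈Kx′ = combine₂ 1# 1# (trans (sym (h≈γT+K x)) (trans hx≈hx′ (h≈γT+K x′))) (×-congʳ g Tx≈Tx′)
      (solve 4 (λ p q w z → w :+ z := con true :* (p :+ w :+ (q :+ z)) :+ con true :* (p :+ q))
        refl (g × T x) (g × T x′) (K x) (K x′))
    by-cases : Dec (L x ≈ 0#) → x ≈ x′
    by-cases (yes Lx≈0) = x+y≈0⇒x≈y (L-kernel a
      (trans (T.homo x x′) (x≈y⇒x+y≈0 Tx≈Tx′))
      (trans (L.homo x x′) (x≈y⇒x+y≈0 (trans Lx≈0
        (sym (K≈0⇒L≈0 (trans (sym Kx≈Kx′) (L≈0⇒K≈0 Lx≈0))))))))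
    by-cases (no Lx≉0) = factorisation-injective a (factorise a x≉0 (x²K x))
      (factorise a x′≉0 (trans (*-congˡ Kx≈Kx′) (x²K x′))) x≉0 Lx≉0 Lx′≉0 (x²K x) Tx≈Tx′
      where
      x≉0 : x ≉ 0#
      x≉0 = Lx≉0 ∘ L-0
      Lx′≉0 : L x′ ≉ 0#
      Lx′≉0 Lx′≈0 = Lx≉0 (K≈0⇒L≈0 (trans Kx≈Kx′ (L≈0⇒K≈0 Lx′≈0)))
      x′≉0 : x′ ≉ 0#
      x′≉0 = Lx′≉0 ∘ L-0

  h-cong : ∀ {x y} → x ≈ y → h x ≈ h y
  h-cong = eval-cong (H m k r α γ)

  𝐓-resp : ∀ {e x y} → x ≈ y → 𝐓 m e x → 𝐓 m e y
  𝐓-resp x≈y = trans (eval-cong (Tr m) (sym x≈y))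

  𝐓⇒T : ∀ {e x} → 𝐓 m e x → T x ≈ (e % 2) × 1#
  𝐓⇒T {x = x} = trans (sym (eval-Tr x))

  T⇒𝐓 : ∀ {e x} → T x ≈ (e % 2) × 1# → 𝐓 m e x
  T⇒𝐓 {x = x} = trans (eval-Tr x)

  -- Injectivity on a trace class is known, so surjectivity is a matter of counting: `g` compares
  -- the sizes of the complements.
  mapsBijectively : ∀ d e (g : Carrier → Carrier) → (∀ {x y} → g x ≈ g y → x ≈ y) →
    (∀ {x} → ¬ 𝐓 m d x → ¬ 𝐓 m e (g x)) → (∀ {x} → 𝐓 m d x → 𝐓 m e (h x)) →
    MapsBijectively setoid h (𝐓 m d) (𝐓 m e)
  mapsBijectively d e g g-inj g-maps h-maps = h-maps ,
    (λ {(_ , Tx)} {(_ , Tx′)} → h-injective (trans (𝐓⇒T {d} Tx) (sym (𝐓⇒T {d} Tx′)))) ,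
    λ (y , Ty) → let x , Tx , hx≈y = preimage Ty in
      (x , Tx) , λ z≈x → trans (h-cong z≈x) hx≈y
    where
    preimage = glued-surjective (λ x → eval x (Tr m) ≟ ((d % 2) × 1#)) h g
      h-maps g-maps (𝐓-resp {e})
      (λ Tx Tx′ → h-injective (trans (𝐓⇒T {d} Tx) (sym (𝐓⇒T {d} Tx′)))) g-inj

  ×1-mod2 : ∀ e → e × 1# ≈ (e % 2) × 1#
  ×1-mod2 e = begin
    e × 1#                                        ≡⟨ ≡.cong (_× 1#) (m≡m%n+[m/n]*n e 2) ⟩
    (e % 2 ℕ.+ e / 2 ℕ.* 2) × 1#                  ≈⟨ ×-homo-+ 1# (e % 2) (e / 2 ℕ.* 2) ⟩
    (e % 2) × 1# + (e / 2 ℕ.* 2) × 1#             ≈⟨ +-congˡ (×1-homo-* (e / 2) 2) ⟩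
    (e % 2) × 1# + ((e / 2) × 1#) * (2 × 1#)
      ≈⟨ solve 2 (λ p q → p :+ q :* (con true :+ (con true :+ con false)) := p) refl _ _ ⟩
    (e % 2) × 1#                                  ∎

  s×[e×1] : ∀ e → s × (e × 1#) ≈ (e × 1#) * ((s % 2) × 1#)
  s×[e×1] e = begin
    s × (e × 1#)                   ≈⟨ ×-assocˡ 1# s e ⟩
    (s ℕ.* e) × 1#                 ≈⟨ ×1-homo-* s e ⟩
    (s × 1#) * (e × 1#)            ≈⟨ *-comm _ _ ⟩
    (e × 1#) * (s × 1#)            ≈⟨ *-congˡ (×1-mod2 s) ⟩
    (e × 1#) * ((s % 2) × 1#)      ∎

  h-maps₀ : ∀ {x} → 𝐓 m 0 x → 𝐓 m 0 (h x)
  h-maps₀ {x} Tx = T⇒𝐓 {0} (trans (T-h x) (trans (×-congʳ s (𝐓⇒T {0} Tx)) (trans (s×[e×1] 0) (zeroˡ _))))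

  h-maps₁ : ∀ {x} → 𝐓 m 1 x → 𝐓 m s (h x)
  h-maps₁ {x} Tx = T⇒𝐓 {s} (trans (T-h x) (trans (×-congʳ s (𝐓⇒T {1} Tx))
    (trans (s×[e×1] 1) (trans (*-congʳ (×-homo-1 1#)) (*-identityˡ _)))))

  𝐓₀→𝐓₀ : MapsBijectively setoid h (𝐓 m 0) (𝐓 m 0)
  𝐓₀→𝐓₀ = mapsBijectively 0 0 id id id h-maps₀

  -- For even s not both r and m are even, so m is odd.
  s-even⇒T1≈1 : s % 2 ≡ 0 → T 1# ≈ 1#
  s-even⇒T1≈1 s≡0 = [ (λ T1≈0 → contradiction (r≈0 (trans (sym (powerSum-1 2 m)) T1≈0))
      (m,r-not-both-even (trans (sym (powerSum-1 2 m)) T1≈0))) , id ]′ (idempotent (T-idempotent 1#))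
    where
    r≈0 : m × 1# ≈ 0# → r × 1# ≈ 0#
    r≈0 m≈0 = begin
      r × 1#                                     ≈⟨ +-identityʳ _ ⟨
      r × 1# + 0#                                ≈⟨ +-congˡ (trans (*-congˡ m≈0) (zeroʳ _)) ⟨
      r × 1# + ((a ℕ.+ g) × 1#) * (m × 1#)       ≈⟨ +-congˡ (×1-homo-* (a ℕ.+ g) m) ⟨
      r × 1# + ((a ℕ.+ g) ℕ.* m) × 1#            ≈⟨ ×-homo-+ 1# r _ ⟨
      s × 1#                                     ≈⟨ ×1-mod2 s ⟩
      (s % 2) × 1#                               ≡⟨ ≡.cong (_× 1#) s≡0 ⟩
      0#                                         ∎

  s-parity : s % 2 ≡ 0 ⊎ s % 2 ≡ 1
  s-parity = parity (s % 2) (m%n<n s 2)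
    where
    parity : ∀ e → e ℕ.< 2 → e ≡ 0 ⊎ e ≡ 1
    parity 0 _ = inj₁ ≡.refl
    parity 1 _ = inj₂ ≡.refl
    parity (suc (suc _)) (s≤s (s≤s ()))

  -- For odd `s` source and target coincide and the identity compares the complements. For even `s`
  -- the target is the class of trace 0, and since 1 has trace 1, adding 1 carries one complement
  -- into the other.
  𝐓₁→𝐓ₛ : MapsBijectively setoid h (𝐓 m 1) (𝐓 m s)
  𝐓₁→𝐓ₛ = [ s-even , s-odd ]′ s-parity
    where
    s-odd : s % 2 ≡ 1 → MapsBijectively setoid h (𝐓 m 1) (𝐓 m s)
    s-odd s≡1 = mapsBijectively 1 s id id
      (λ {x} → _∘ ≡.subst (λ e → eval x (Tr m) ≈ e × 1#) s≡1) h-maps₁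
    s-even : s % 2 ≡ 0 → MapsBijectively setoid h (𝐓 m 1) (𝐓 m s)
    s-even s≡0 = mapsBijectively 1 s (_+ 1#)
      (λ eq → combine₁ 1# eq (solve 2 (λ x y → x :+ y := con true :* (x :+ con true :+ (y :+ con true))) refl _ _))
      (λ {x} ¬Tx T[x+1] → ¬Tx (T⇒𝐓 {1} (combine₃ 1# 1# 1# (T.homo x 1#) (s-even⇒T1≈1 s≡0)
        (≡.subst (λ e → T (x + 1#) ≈ e × 1#) s≡0 (𝐓⇒T {s} T[x+1]))
        (solve 3 (λ p q w → p :+ (con true :+ con false) :=
            con true :* (q :+ (p :+ w)) :+ con true :* (w :+ con true) :+ con true :* (q :+ con false))
          refl (T x) (T (x + 1#)) (T 1#)))))
      h-maps₁

  permutation⇔s-odd : IsPermutationPolynomial (baseChange (H m k r α γ)) ⇔ s % 2 ≡ 1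
  permutation⇔s-odd = mk⇔
    (λ permutation → [ (λ s≡0 → contradiction (T1≈0 permutation s≡0) (T1≉0 s≡0)) , id ]′ s-parity)
    (λ s≡1 → h-inj s≡1 , λ y → let x , _ , hx≈y = preimage s≡1 {y} tt in x , λ z≈x → trans (h-cong z≈x) hx≈y)
    where
    T1≉0 : s % 2 ≡ 0 → ¬ (T 1# ≈ 0#)
    T1≉0 s≡0 T1≈0 = 0≉1 (trans (sym T1≈0) (s-even⇒T1≈1 s≡0))
    -- For even `s` the value at 1 has trace 0 and is thus already attained on the class of trace 0;
    -- global injectivity would put 1 in that class.
    T1≈0 : IsPermutationPolynomial (baseChange (H m k r α γ)) → s % 2 ≡ 0 → T 1# ≈ 0#
    T1≈0 (h-inj , _) s≡0 = trans (T.cong (sym (h-inj hx≈h1))) (𝐓⇒T {0} (proj₂ preimage₁))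
      where
      h1∈𝐓₀ : 𝐓 m 0 (h 1#)
      h1∈𝐓₀ = ≡.subst (λ e → eval (h 1#) (Tr m) ≈ e × 1#) s≡0
        (h-maps₁ (T⇒𝐓 {1} (trans (s-even⇒T1≈1 s≡0) (sym (×-homo-1 1#)))))
      preimage₁ : ∃ (𝐓 m 0)
      preimage₁ = proj₁ (proj₂ (proj₂ 𝐓₀→𝐓₀) (h 1# , h1∈𝐓₀))
      hx≈h1 : h (proj₁ preimage₁) ≈ h 1#
      hx≈h1 = proj₂ (proj₂ (proj₂ 𝐓₀→𝐓₀) (h 1# , h1∈𝐓₀)) {preimage₁} refl
    -- For odd `s` the map preserves the trace, so equal values force equal traces and `h-injective`
    -- applies globally.
    T-h-odd : s % 2 ≡ 1 → ∀ x → T (h x) ≈ T x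
    T-h-odd s≡1 x = begin
      T (h x)               ≈⟨ T-h x ⟩
      s × T x               ≈⟨ ×-congʳ s (*-identityˡ (T x)) ⟨
      s × (1# * T x)        ≈⟨ ×-assoc-* s 1# (T x) ⟨
      (s × 1#) * T x        ≈⟨ *-congʳ (×1-mod2 s) ⟩
      ((s % 2) × 1#) * T x  ≡⟨ ≡.cong (λ e → (e × 1#) * T x) s≡1 ⟩
      (1 × 1#) * T x        ≈⟨ *-congʳ (×-homo-1 1#) ⟩
      1# * T x              ≈⟨ *-identityˡ (T x) ⟩
      T x                   ∎
    h-inj : s % 2 ≡ 1 → Injective _≈_ _≈_ h
    h-inj s≡1 {x} {x′} hx≈hx′ = h-injective
      (trans (sym (T-h-odd s≡1 x)) (trans (T.cong hx≈hx′) (T-h-odd s≡1 x′))) hx≈hx′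
    -- Counting again, now with the whole field on both sides and empty complements.
    preimage : s % 2 ≡ 1 → ∀ {y} → ⊤ → ∃ λ x → ⊤ Product.× h x ≈ y
    preimage s≡1 = glued-surjective {A = λ _ → ⊤} {B = λ _ → ⊤} (λ _ → yes tt) h id
      (λ _ → tt) (λ ¬⊤ _ → ¬⊤ tt) (λ _ _ → tt) (λ _ _ → h-inj s≡1) id

-- From the arithmetic hypotheses to the conclusion.

open import Data.Nat.Base using (_+_; _*_; _^_; _≤_; _<_)
open import Data.Nat.GCD using (gcd)
open import Data.Product.Base using (_×_)

theorem1p2 : ∀ {c ℓ} (m k : ℕ) .{{_ : NonZero m}} .{{_ : NonZero k}} →
    gcd k m ≡ 1 →
    (r : ℕ) → 1 ≤ r → r < m → (k * r) % m ≡ 1 % m →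
    (α γ : Fin 2) →
    (𝔽 : Field c ℓ) → HasOrder 𝔽 (2 ^ m) →
    let open Over 𝔽
        h = baseChange (H m k r α γ)
        s = r + (toℕ α + toℕ γ) * m
    in MapsBijectively (Field.setoid 𝔽) ⟦ h ⟧ (𝐓 m 0) (𝐓 m 0)
     × MapsBijectively (Field.setoid 𝔽) ⟦ h ⟧ (𝐓 m 1) (𝐓 m s)
     × (IsPermutationPolynomial h ⇔ s % 2 ≡ 1)
theorem1p2 m@(suc m-1) k _ r 1≤r r<m kr%m≡1%m α γ 𝔽 enum = 𝐓₀→𝐓₀ , 𝐓₁→𝐓ₛ , permutation⇔s-odd
  where
  -- The bounds `1 ≤ r < m` give `1 < m`, so `1 % m` is 1, and `t` is the quotient of `k * r` by
  -- `m`.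
  kr≡1+tm : k * r ≡ 1 + ((k * r) / m) * m
  kr≡1+tm = ≡.trans (m≡m%n+[m/n]*n (k * r) m)
    (≡.cong (_+ ((k * r) / m) * m) (≡.trans kr%m≡1%m (m<n⇒m%n≡m (ℕₚ.≤-<-trans 1≤r r<m))))
  open Mapping 𝔽 enum (even-order⇒1+1≈0 𝔽 (2 ^ m-1) enum) m k r ((k * r) / m) (fermat 𝔽 enum) kr≡1+tm α γ
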